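{- Let $C$ be a pGCL program, let $\varphi,\varphi'$ be predicates over program states, and let $C_{\mathrm{loop}} = \mathtt{while}(\varphi)\{C\}$ and $C'_{\mathrm{loop}} = \mathtt{while}(\varphi')\{C\}$. Let $f, l \in \mathbb{E}$ be expectations (with $f$ the postexpectation). If $\varphi' \Rightarrow \varphi$ and $$l \preceq \mathrm{wp}[\![C'_{\mathrm{loop}}]\!]([\neg\varphi]\cdot f),$$ then $$l \preceq \mathrm{wp}[\![C_{\mathrm{loop}}]\!](f).$$
   Context: States and predicates: $\mathrm{Vars}$ is a countable set of program variables; a program state is a map $\sigma\colon \mathrm{Vars}\to\mathbb{R}$, and $\Sigma$ is the set of all program states (with the product Borel $\sigma$-algebra). A predicate $\varphi$ (a loop guard or branching condition) is identified with a measurable subset of $\Sigma$; $\sigma\models\varphi$ means $\sigma$ lies in that subset, $\neg,\wedge,\vee$ are the Boolean operations on subsets, and $\varphi'\Rightarrow\varphi$ ("$\varphi'$ strengthens $\varphi$") means that every state satisfying $\varphi'$ satisfies $\varphi$. The Iverson bracket $[\varphi]\colon\Sigma\to\{0,1\}$ is the indicator function of $\varphi$. pGCL programs: generated by the grammar $C ::= \mathtt{skip} \mid x:=e \mid x:\approx\mu \mid C;C \mid \{C\}\,[p]\,\{C\} \mid \mathtt{if}(\varphi)\{C\}\mathtt{else}\{C\} \mid \mathtt{while}(\varphi)\{C\}$, where $x\in\mathrm{Vars}$, $e$ is an arithmetic expression (a measurable function $\Sigma\to\mathbb{R}$), $\mu$ is a (discrete or continuous) probability distribution on $\mathbb{R}$,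 $p\in[0,1]$, and $\varphi$ is a predicate. Loop bodies may themselves contain loops. Expectations: $\mathbb{E}$ is the set of measurable functions $f\colon\Sigma\to[0,\infty]$, ordered pointwise: $f\preceq g$ iff $f(\sigma)\le g(\sigma)$ for all $\sigma\in\Sigma$. Convention $0\cdot\infty=0$. Weakest preexpectation $\mathrm{wp}[\![C]\!]\colon\mathbb{E}\to\mathbb{E}$: $\mathrm{wp}[\![C]\!](f)(\sigma_0)=\int_\Sigma f\,d\mu^{C}_{\sigma_0}$, where $\mu^{C}_{\sigma_0}$ is the subprobability measure over final states reached after termination of $C$ on input $\sigma_0$ (the missing mass is the probability of nontermination). Equivalently, it is defined inductively by: $\mathrm{wp}[\![\mathtt{skip}]\!](f)=f$; $\mathrm{wp}[\![x:=e]\!](f)(\sigma)=f(\sigma[x\mapsto e(\sigma)])$; $\mathrm{wp}[\![x:\approx\mu]\!](f)(\sigma)=\int_{\mathbb{R}}f(\sigma[x\mapsto\nu])\,d\mu(\nu)$; $\mathrm{wp}[\![C_1;C_2]\!](f)=\mathrm{wp}[\![C_1]\!](\mathrm{wp}[\![C_2]\!](f))$; $\mathrm{wp}[\![\{C_1\}[p]\{C_2\}]\!](f)=p\cdot\mathrm{wp}[\![C_1]\!](f)+(1-p)\cdot\mathrm{wp}[\![C_2]\!](f)$; $\mathrm{wp}[\![\mathtt{if}(\varphi)\{C_1\}\mathtt{else}\{C_2\}]\!](f)=[\varphi]\cdot\mathrm{wp}[\![C_1]\!](f)+[\neg\varphi]\cdot\mathrm{wp}[\![C_2]\!](f)$;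 and $\mathrm{wp}[\![\mathtt{while}(\varphi)\{C\}]\!](f)$ is the least fixed point, with respect to $\preceq$, of the map $h\mapsto[\neg\varphi]\cdot f+[\varphi]\cdot\mathrm{wp}[\![C]\!](h)$ on $\mathbb{E}$. -}

module Defs where

open import Axiom.ExcludedMiddle using (ExcludedMiddle)
open import Data.Empty using (⊥; ⊥-elim)
open import Data.Integer.Base using (-[1+_]) renaming (+_ to pos)
open import Data.List.Base using (List; []; _∷_; _++_; length)
open import Data.Nat.Base using (ℕ; zero; suc) renaming (_⊔_ to _⊔ⁿ_; _≤_ to _≤ⁿ_; _<_ to _<ⁿ_)
import Data.Nat.Properties as ℕ
open import Data.Product using (Σ-syntax; ∃-syntax; _×_; _,_; proj₁; proj₂)
open import Data.Rational.Base
  using (ℚ; 0ℚ; 1ℚ; _+_; _-_; _*_; -_; _≤_; _<_; _⊔_; ∣_∣; _/_; 1/_; ↥_; ↧ₙ_; nonNegative; positive; >-nonZero)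
import Data.Rational.Properties as ℚ
open import Data.Rational.Solver using (module +-*-Solver)
open import Data.Sum.Base using (_⊎_; inj₁; inj₂; [_,_])
open import Function.Base using (_∘_; id)
open import Function.Bundles using (_⇔_; mk⇔; module Equivalence; _↣_; module Injection)
open import Level using (Level; 0ℓ) renaming (suc to lsuc; _⊔_ to _⊔ˡ_)
open import Relation.Binary.PropositionalEquality using (_≡_; _≢_; refl; sym; trans; cong; subst)
open import Relation.Binary.Definitions using (tri<; tri≈; tri>)
open import Relation.Nullary using (¬_; Dec; yes; no; contradiction)

open +-*-Solver using (solve; _:=_; _:+_; _:*_; _:-_; :-_; con)

open Equivalence using (to; from)

-- Bishop's regular sequences of rationals.  Everything below only inspects
-- a real through the two (open) comparisons with rationals, hence respects
-- the equality "same rationals below, same rationals above".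
record ℝ : Set where
  field
    approx  : ℕ → ℚ
    regular : ∀ m n → ∣ approx m - approx n ∣ ≤ pos 1 / suc m + pos 1 / suc n

open ℝ

infix 4 _<ʳ_ _ʳ<_

_<ʳ_ : ℚ → ℝ → Set
q <ʳ x = ∃[ n ] q + pos 1 / suc n < approx x n

_ʳ<_ : ℝ → ℚ → Set
x ʳ< q = ∃[ n ] approx x n + pos 1 / suc n < q

1-ʳ_ : ℝ → ℝ
approx  (1-ʳ x) n   = 1ℚ - approx x n
regular (1-ʳ x) m n = subst (_≤ pos 1 / suc m + pos 1 / suc n)
  (trans (sym (ℚ.∣-p∣≡∣p∣ _)) (cong ∣_∣ (flip (approx x m) (approx x n)))) (regular x m n)
  where
  flip : ∀ p q → - (p - q) ≡ (1ℚ - p) - (1ℚ - q)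
  flip = solve 2 (λ p q → :- (p :- q) := (con 1ℚ :- p) :- (con 1ℚ :- q)) refl

-- [0,∞]: the number a is given by the set of the rationals q < a; ∞ is ℚ itself.
record ℝ∞ : Set₁ where
  no-eta-equality
  field
    below    : ℚ → Set
    negative : ∀ {q} → q < 0ℚ → below q
    downward : ∀ {p q} → p ≤ q → below q → below p
    rounded  : ∀ {q} → below q → ∃[ r ] q < r × below r

open ℝ∞

infix 4 _≤∞_ _≈∞_

record _≤∞_ (a b : ℝ∞) : Set where
  constructor le
  field
    below-mono : ∀ {q} → below a q → below b q

open _≤∞_

_≈∞_ : ℝ∞ → ℝ∞ → Set
a ≈∞ b = a ≤∞ b × b ≤∞ a

≤∞-refl : ∀ {a} → a ≤∞ a
≤∞-refl = le id

≤∞-trans : ∀ {a b c} → a ≤∞ b → b ≤∞ c → a ≤∞ c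
≤∞-trans (le f) (le g) = le (g ∘ f)

≈∞-refl : ∀ {a} → a ≈∞ a
≈∞-refl = ≤∞-refl , ≤∞-refl

≈∞-sym : ∀ {a b} → a ≈∞ b → b ≈∞ a
≈∞-sym (p , q) = q , p

≈∞-trans : ∀ {a b c} → a ≈∞ b → b ≈∞ c → a ≈∞ c
≈∞-trans (p , q) (r , s) = ≤∞-trans p r , ≤∞-trans s q

private
  p-q+q : ∀ p q → (p - q) + q ≡ p
  p-q+q = solve 2 (λ p q → (p :- q) :+ q := p) refl

  q+⟨p-q⟩ : ∀ p q → q + (p - q) ≡ p
  q+⟨p-q⟩ = solve 2 (λ p q → q :+ (p :- q) := p) refl

  ⟨p+q⟩-q : ∀ p q → (p + q) - q ≡ p
  ⟨p+q⟩-q = solve 2 (λ p q → (p :+ q) :- q := p) refl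

  sub-mono-< : ∀ {p q} r → p < q → p - r < q - r
  sub-mono-< r p<q = ℚ.+-monoˡ-< (- r) p<q

  +-≤⇒≤- : ∀ {p q r} → p + r < q → p < q - r
  +-≤⇒≤- {p} {q} {r} h = subst (_< q - r) (⟨p+q⟩-q p r) (sub-mono-< r h)

  p<q⇒p-q<0 : ∀ {p q} → p < q → p - q < 0ℚ
  p<q⇒p-q<0 {p} {q} h = subst (p - q <_) (ℚ.+-inverseʳ q) (sub-mono-< q h)

  *-mono-≤ : ∀ {p q r s} → 0ℚ ≤ p → 0ℚ ≤ s → p ≤ q → r ≤ s → p * r ≤ q * s
  *-mono-≤ {p} {q} {r} {s} 0≤p 0≤s p≤q r≤s = ℚ.≤-trans
    (ℚ.*-monoˡ-≤-nonNeg p {{nonNegative 0≤p}} r≤s)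
    (ℚ.*-monoʳ-≤-nonNeg s {{nonNegative 0≤s}} p≤q)

  *-mono-< : ∀ {p q r s} → 0ℚ ≤ p → 0ℚ ≤ r → p < q → r < s → p * r < q * s
  *-mono-< {p} {q} {r} {s} 0≤p 0≤r p<q r<s = ℚ.≤-<-trans
    (ℚ.*-monoˡ-≤-nonNeg p {{nonNegative 0≤p}} (ℚ.<⇒≤ r<s))
    (ℚ.*-monoˡ-<-pos s {{positive (ℚ.≤-<-trans 0≤r r<s)}} p<q)

  <⇒≱ : ∀ {p q} → p < q → ¬ (q ≤ p)
  <⇒≱ p<q q≤p = ℚ.<-irrefl refl (ℚ.<-≤-trans p<q q≤p)

  <0⊎0≤ : ∀ q → q < 0ℚ ⊎ 0ℚ ≤ q
  <0⊎0≤ q with q ℚ.<? 0ℚ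
  ... | yes h = inj₁ h
  ... | no  h = inj₂ (ℚ.≮⇒≥ h)

  rounded-negative : ∀ {P : ℚ → Set} {q} → q < 0ℚ → ∃[ r ] q < r × (r < 0ℚ ⊎ P r)
  rounded-negative q<0 = let r , q<r , r<0 = ℚ.<-dense q<0 in r , q<r , inj₁ r<0

-- max(q,0) for rational q
ι : ℚ → ℝ∞
below    (ι p) q          = q < 0ℚ ⊎ q < p
negative (ι p)            = inj₁
downward (ι p) q≤r        = [ inj₁ ∘ ℚ.≤-<-trans q≤r , inj₂ ∘ ℚ.≤-<-trans q≤r ]
rounded  (ι p) (inj₁ q<0) = rounded-negative q<0
rounded  (ι p) (inj₂ q<p) = let r , q<r , r<p = ℚ.<-dense q<p in r , q<r , inj₂ r<p

0∞ 1∞ : ℝ∞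
0∞ = ι 0ℚ
1∞ = ι 1ℚ

private
  shift-dense : ∀ {q x e} → q + e < x → ∃[ r ] q < r × r + e < x
  shift-dense {q} {x} {e} h =
    let t , q+e<t , t<x = ℚ.<-dense h
    in t - e , +-≤⇒≤- q+e<t , subst (_< x) (sym (p-q+q t e)) t<x

-- max(x,0) for real x
fromℝ : ℝ → ℝ∞
below    (fromℝ x) q                = q < 0ℚ ⊎ q <ʳ x
negative (fromℝ x)                  = inj₁
downward (fromℝ x) q≤r (inj₁ r<0)   = inj₁ (ℚ.≤-<-trans q≤r r<0)
downward (fromℝ x) q≤r (inj₂ (n , h)) = inj₂ (n , ℚ.≤-<-trans (ℚ.+-monoˡ-≤ _ q≤r) h)
rounded  (fromℝ x) (inj₁ q<0)       = rounded-negative q<0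
rounded  (fromℝ x) (inj₂ (n , h))   = let r , q<r , h′ = shift-dense h in r , q<r , inj₂ (n , h′)

infixl 6 _+∞_
infixl 7 _*∞_

_+∞_ : ℝ∞ → ℝ∞ → ℝ∞
below    (a +∞ b) q = ∃[ r ] ∃[ s ] below a r × below b s × q ≤ r + s
negative (a +∞ b) {q} q<0 =
  let r , q<r , r<0 = ℚ.<-dense q<0
  in r , q - r , negative a r<0 , negative b (p<q⇒p-q<0 q<r) , ℚ.≤-reflexive (sym (q+⟨p-q⟩ q r))
downward (a +∞ b) p≤q (r , s , ra , sb , h) = r , s , ra , sb , ℚ.≤-trans p≤q h
rounded  (a +∞ b) (r , s , ra , sb , h) =
  let r′ , r<r′ , ra′ = rounded a ra
  in r′ + s , ℚ.≤-<-trans h (ℚ.+-monoˡ-< s r<r′) , r′ , s , ra′ , sb , ℚ.≤-refl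

-- In particular 0 · ∞ = 0.
_*∞_ : ℝ∞ → ℝ∞ → ℝ∞
below    (a *∞ b) q = q < 0ℚ ⊎ (∃[ r ] ∃[ s ] 0ℚ ≤ r × 0ℚ ≤ s × below a r × below b s × q ≤ r * s)
negative (a *∞ b) = inj₁
downward (a *∞ b) p≤q (inj₁ q<0) = inj₁ (ℚ.≤-<-trans p≤q q<0)
downward (a *∞ b) p≤q (inj₂ (r , s , 0≤r , 0≤s , ra , sb , h)) =
  inj₂ (r , s , 0≤r , 0≤s , ra , sb , ℚ.≤-trans p≤q h)
rounded  (a *∞ b) (inj₁ q<0) = rounded-negative q<0
rounded  (a *∞ b) (inj₂ (r , s , 0≤r , 0≤s , ra , sb , h)) =
  let r′ , r<r′ , ra′ = rounded a ra
      s′ , s<s′ , sb′ = rounded b sb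
  in r′ * s′ , ℚ.≤-<-trans h (*-mono-< 0≤r 0≤s r<r′ s<s′) ,
     inj₂ (r′ , s′ , ℚ.≤-trans 0≤r (ℚ.<⇒≤ r<r′) , ℚ.≤-trans 0≤s (ℚ.<⇒≤ s<s′) , ra′ , sb′ , ℚ.≤-refl)

⨆ : (ℕ → ℝ∞) → ℝ∞
below    (⨆ u) q = ∃[ n ] below (u n) q
negative (⨆ u) q<0 = 0 , negative (u 0) q<0
downward (⨆ u) p≤q (n , h) = n , downward (u n) p≤q h
rounded  (⨆ u) (n , h) = let r , q<r , h′ = rounded (u n) h in r , q<r , n , h′

∑< : ℕ → (ℕ → ℝ∞) → ℝ∞
∑< zero    u = 0∞
∑< (suc n) u = ∑< n u +∞ u n

∑ : (ℕ → ℝ∞) → ℝ∞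
∑ u = ⨆ λ n → ∑< n u

private
  variable
    a b c d : ℝ∞

0≤∞ : 0∞ ≤∞ a
0≤∞ {a} = le [ negative a , negative a ]

+-mono : a ≤∞ b → c ≤∞ d → a +∞ c ≤∞ b +∞ d
+-mono (le f) (le g) = le λ (r , s , ra , sb , h) → r , s , f ra , g sb , h

*-mono : a ≤∞ b → c ≤∞ d → a *∞ c ≤∞ b *∞ d
*-mono (le f) (le g) = le λ
  { (inj₁ q<0) → inj₁ q<0
  ; (inj₂ (r , s , 0≤r , 0≤s , ra , sb , h)) → inj₂ (r , s , 0≤r , 0≤s , f ra , g sb , h)
  }

+-cong : a ≈∞ b → c ≈∞ d → a +∞ c ≈∞ b +∞ d
+-cong (p , q) (r , s) = +-mono p r , +-mono q s

*-cong : a ≈∞ b → c ≈∞ d → a *∞ c ≈∞ b *∞ d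
*-cong (p , q) (r , s) = *-mono p r , *-mono q s

+-comm : ∀ a b → a +∞ b ≤∞ b +∞ a
+-comm a b = le λ { {q} (r , s , ra , sb , h) → s , r , sb , ra , subst (q ≤_) (ℚ.+-comm r s) h }

*-comm : ∀ a b → a *∞ b ≤∞ b *∞ a
*-comm a b = le λ
  { (inj₁ q<0) → inj₁ q<0
  ; {q} (inj₂ (r , s , 0≤r , 0≤s , ra , sb , h)) →
      inj₂ (s , r , 0≤s , 0≤r , sb , ra , subst (q ≤_) (ℚ.*-comm r s) h)
  }

interchange : ∀ a b c d → (a +∞ b) +∞ (c +∞ d) ≤∞ (a +∞ c) +∞ (b +∞ d)
interchange a b c d = le λ
  { {q} (r , s , (r₁ , r₂ , h₁ , h₂ , hr) , (s₁ , s₂ , k₁ , k₂ , hs) , h) →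
      r₁ + s₁ , r₂ + s₂ , (r₁ , s₁ , h₁ , k₁ , ℚ.≤-refl) , (r₂ , s₂ , h₂ , k₂ , ℚ.≤-refl) ,
      ℚ.≤-trans h (subst (r + s ≤_) (shuffle r₁ r₂ s₁ s₂) (ℚ.+-mono-≤ hr hs)) }
  where
  shuffle : ∀ p q r s → (p + q) + (r + s) ≡ (p + r) + (q + s)
  shuffle = solve 4 (λ p q r s → (p :+ q) :+ (r :+ s) := (p :+ r) :+ (q :+ s)) refl

+-identityʳ-≤ : a +∞ 0∞ ≤∞ a
+-identityʳ-≤ {a} = le λ
  { {q} (r , s , ra , s<0 , h) → downward a
      (ℚ.≤-trans h (subst (r + s ≤_) (ℚ.+-identityʳ r) (ℚ.+-monoʳ-≤ r (ℚ.<⇒≤ ([ id , id ] s<0))))) ra }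

a≤a+b : a ≤∞ a +∞ b
a≤a+b {a} {b} = le λ {q} h →
  let r , q<r , ra = rounded a h
  in r , q - r , ra , negative b (p<q⇒p-q<0 q<r) , ℚ.≤-reflexive (sym (q+⟨p-q⟩ q r))

b≤a+b : b ≤∞ a +∞ b
b≤a+b {b} {a} = ≤∞-trans a≤a+b (+-comm b a)

+-identityʳ : a +∞ 0∞ ≈∞ a
+-identityʳ = +-identityʳ-≤ , a≤a+b

+-identityˡ : 0∞ +∞ a ≈∞ a
+-identityˡ {a} = ≤∞-trans (+-comm 0∞ a) +-identityʳ-≤ , b≤a+b

+-assoc-≤ : ∀ a b c → (a +∞ b) +∞ c ≤∞ a +∞ (b +∞ c)
+-assoc-≤ a b c = ≤∞-trans (+-mono (≤∞-refl {a +∞ b}) (b≤a+b {c} {0∞}))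
  (≤∞-trans (interchange a b 0∞ c) (+-mono (+-identityʳ-≤ {a}) (≤∞-refl {b +∞ c})))

+-assoc-≥ : ∀ a b c → a +∞ (b +∞ c) ≤∞ (a +∞ b) +∞ c
+-assoc-≥ a b c = ≤∞-trans (+-mono (a≤a+b {a} {0∞}) (≤∞-refl {b +∞ c}))
  (≤∞-trans (interchange a 0∞ b c) (+-mono (≤∞-refl {a +∞ b}) (proj₁ (+-identityˡ {c}))))

*-zeroˡ : 0∞ *∞ a ≤∞ 0∞
*-zeroˡ = le [ inj₁ , (λ (r , s , 0≤r , _ , r<0 , _) →
  ⊥-elim (<⇒≱ ([ id , id ] r<0) 0≤r)) ]

*-zeroʳ : a *∞ 0∞ ≤∞ 0∞
*-zeroʳ {a} = ≤∞-trans (*-comm a 0∞) *-zeroˡ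

*-identityˡ-≤ : 1∞ *∞ a ≤∞ a
*-identityˡ-≤ {a} = le
  [ negative a
  , (λ (r , s , 0≤r , 0≤s , r<1 , sa , h) → downward a
       (ℚ.≤-trans h (subst (r * s ≤_) (ℚ.*-identityˡ s)
         (ℚ.*-monoʳ-≤-nonNeg s {{nonNegative 0≤s}} (r≤1 r<1)))) sa)
  ]
  where
  r≤1 : ∀ {r} → r < 0ℚ ⊎ r < 1ℚ → r ≤ 1ℚ
  r≤1 (inj₁ r<0) = ℚ.<⇒≤ (ℚ.<-trans r<0 (ℚ.positive⁻¹ 1ℚ))
  r≤1 (inj₂ r<1) = ℚ.<⇒≤ r<1

*-identityˡ-≥ : a ≤∞ 1∞ *∞ a
*-identityˡ-≥ {a} = le λ {q} qa → helper q qa (<0⊎0≤ q)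
  where
  helper : ∀ q → below a q → q < 0ℚ ⊎ 0ℚ ≤ q → below (1∞ *∞ a) q
  helper q qa (inj₁ q<0) = inj₁ q<0
  helper q qa (inj₂ 0≤q) with r , q<r , ra ← rounded a qa =
    inj₂ (q * 1/r , r , 0≤s , 0≤r , inj₂ s<1 , ra , ℚ.≤-reflexive (sym s*r≡q))
    where
    0<r : 0ℚ < r
    0<r = ℚ.≤-<-trans 0≤q q<r
    0≤r : 0ℚ ≤ r
    0≤r = ℚ.<⇒≤ 0<r
    1/r : ℚ
    1/r = (1/ r) {{>-nonZero 0<r}}
    0<1/r : 0ℚ < 1/r
    0<1/r = ℚ.positive⁻¹ 1/r {{ℚ.1/pos⇒pos r {{positive 0<r}}}}
    0≤s : 0ℚ ≤ q * 1/r
    0≤s = subst (_≤ q * 1/r) (ℚ.*-zeroˡ 1/r) (ℚ.*-monoʳ-≤-nonNeg 1/r {{nonNegative (ℚ.<⇒≤ 0<1/r)}} 0≤q)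
    s<1 : q * 1/r < 1ℚ
    s<1 = subst (q * 1/r <_) (ℚ.*-inverseʳ r {{>-nonZero 0<r}}) (ℚ.*-monoˡ-<-pos 1/r {{positive 0<1/r}} q<r)
    s*r≡q : q * 1/r * r ≡ q
    s*r≡q = trans (ℚ.*-assoc q 1/r r)
      (trans (cong (q *_) (ℚ.*-inverseˡ r {{>-nonZero 0<r}})) (ℚ.*-identityʳ q))

*-distribʳ-≤ : ∀ a b c → (a +∞ b) *∞ c ≤∞ a *∞ c +∞ b *∞ c
*-distribʳ-≤ a b c = le
  [ negative (a *∞ c +∞ b *∞ c)
  , (λ (r , s , 0≤r , 0≤s , (r₁ , r₂ , h₁ , h₂ , hr) , sc , h) →
       go r₁ r₂ s h₁ h₂ sc 0≤s (ℚ.≤-trans 0≤r hr) (ℚ.≤-trans h (ℚ.*-monoʳ-≤-nonNeg s {{nonNegative 0≤s}} hr))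
         (<0⊎0≤ r₁) (<0⊎0≤ r₂))
  ]
  where
  go : ∀ {q} r₁ r₂ s → below a r₁ → below b r₂ → below c s → 0ℚ ≤ s → 0ℚ ≤ r₁ + r₂ → q ≤ (r₁ + r₂) * s →
       r₁ < 0ℚ ⊎ 0ℚ ≤ r₁ → r₂ < 0ℚ ⊎ 0ℚ ≤ r₂ → below (a *∞ c +∞ b *∞ c) q
  go {q} r₁ r₂ s h₁ h₂ sc 0≤s 0≤r h (inj₂ 0≤r₁) (inj₂ 0≤r₂) =
    r₁ * s , r₂ * s , inj₂ (r₁ , s , 0≤r₁ , 0≤s , h₁ , sc , ℚ.≤-refl) ,
    inj₂ (r₂ , s , 0≤r₂ , 0≤s , h₂ , sc , ℚ.≤-refl) ,
    subst (q ≤_) (ℚ.*-distribʳ-+ s r₁ r₂) h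
  go {q} r₁ r₂ s h₁ h₂ sc 0≤s 0≤r h (inj₁ r₁<0) (inj₂ 0≤r₂) =
    below-mono (b≤a+b {b *∞ c} {a *∞ c}) (inj₂ (r₂ , s , 0≤r₂ , 0≤s , h₂ , sc ,
      ℚ.≤-trans h (ℚ.*-monoʳ-≤-nonNeg s {{nonNegative 0≤s}}
        (subst (r₁ + r₂ ≤_) (ℚ.+-identityˡ r₂) (ℚ.+-monoˡ-≤ r₂ (ℚ.<⇒≤ r₁<0))))))
  go {q} r₁ r₂ s h₁ h₂ sc 0≤s 0≤r h (inj₂ 0≤r₁) (inj₁ r₂<0) =
    below-mono (a≤a+b {a *∞ c} {b *∞ c}) (inj₂ (r₁ , s , 0≤r₁ , 0≤s , h₁ , sc ,
      ℚ.≤-trans h (ℚ.*-monoʳ-≤-nonNeg s {{nonNegative 0≤s}}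
        (subst (r₁ + r₂ ≤_) (ℚ.+-identityʳ r₁) (ℚ.+-monoʳ-≤ r₁ (ℚ.<⇒≤ r₂<0))))))
  go r₁ r₂ s h₁ h₂ sc 0≤s 0≤r h (inj₁ r₁<0) (inj₁ r₂<0) =
    ⊥-elim (<⇒≱ (ℚ.+-mono-< r₁<0 r₂<0) 0≤r)

*-distribʳ-≥ : ∀ a b c → a *∞ c +∞ b *∞ c ≤∞ (a +∞ b) *∞ c
*-distribʳ-≥ a b c = le λ { (x , y , xa , yb , h) → go xa yb h }
  where
  go : ∀ {q x y} → below (a *∞ c) x → below (b *∞ c) y → q ≤ x + y → below ((a +∞ b) *∞ c) q
  go {q} {x} {y} (inj₁ x<0) yb h = downward ((a +∞ b) *∞ c)
    (ℚ.≤-trans h (subst (x + y ≤_) (ℚ.+-identityˡ y) (ℚ.+-monoˡ-≤ y (ℚ.<⇒≤ x<0))))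
    (below-mono (*-mono (b≤a+b {b} {a}) (≤∞-refl {c})) yb)
  go {q} {x} {y} xa@(inj₂ _) (inj₁ y<0) h = downward ((a +∞ b) *∞ c)
    (ℚ.≤-trans h (subst (x + y ≤_) (ℚ.+-identityʳ x) (ℚ.+-monoʳ-≤ x (ℚ.<⇒≤ y<0))))
    (below-mono (*-mono (a≤a+b {a} {b}) (≤∞-refl {c})) xa)
  go {q} {x} {y} (inj₂ (r₁ , s₁ , 0≤r₁ , 0≤s₁ , h₁ , k₁ , hx))
                 (inj₂ (r₂ , s₂ , 0≤r₂ , 0≤s₂ , h₂ , k₂ , hy)) h =
    inj₂ (r₁ + r₂ , s , ℚ.+-mono-≤ 0≤r₁ 0≤r₂ , 0≤s , (r₁ , r₂ , h₁ , h₂ , ℚ.≤-refl) , sc ,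
      ℚ.≤-trans h (subst (x + y ≤_) (sym (ℚ.*-distribʳ-+ s r₁ r₂))
        (ℚ.+-mono-≤ (ℚ.≤-trans hx (*-mono-≤ 0≤r₁ 0≤s ℚ.≤-refl (ℚ.p≤p⊔q s₁ s₂)))
                    (ℚ.≤-trans hy (*-mono-≤ 0≤r₂ 0≤s ℚ.≤-refl (ℚ.p≤q⊔p s₁ s₂))))))
    where
    s : ℚ
    s = s₁ ⊔ s₂
    0≤s : 0ℚ ≤ s
    0≤s = ℚ.≤-trans 0≤s₁ (ℚ.p≤p⊔q s₁ s₂)
    sc : below c s
    sc with ℚ.⊔-sel s₁ s₂
    ... | inj₁ e = subst (below c) (sym e) k₁
    ... | inj₂ e = subst (below c) (sym e) k₂

*-distribˡ-≤ : ∀ a b c → a *∞ (b +∞ c) ≤∞ a *∞ b +∞ a *∞ c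
*-distribˡ-≤ a b c = ≤∞-trans (*-comm a (b +∞ c)) (≤∞-trans (*-distribʳ-≤ b c a) (+-mono (*-comm b a) (*-comm c a)))

*-distribˡ-≥ : ∀ a b c → a *∞ b +∞ a *∞ c ≤∞ a *∞ (b +∞ c)
*-distribˡ-≥ a b c = ≤∞-trans (+-mono (*-comm a b) (*-comm a c)) (≤∞-trans (*-distribʳ-≥ b c a) (*-comm (b +∞ c) a))

ι-≤ : ∀ {q} → below a q → ι q ≤∞ a
ι-≤ {a} h = le [ negative a , (λ p<q → downward a (ℚ.<⇒≤ p<q) h) ]

ι-mono : ∀ {p q} → p ≤ q → ι p ≤∞ ι q
ι-mono p≤q = le [ inj₁ , (λ r<p → inj₂ (ℚ.<-≤-trans r<p p≤q)) ]

Chain : (ℕ → ℝ∞) → Set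
Chain u = ∀ n → u n ≤∞ u (suc n)

chain-mono : ∀ {u} → Chain u → ∀ {m n} → m ≤ⁿ n → u m ≤∞ u n
chain-mono {u} ch = go ∘ ℕ.≤⇒≤′
  where
  open import Data.Nat.Base using (_≤′_; ≤′-refl; ≤′-step)
  go : ∀ {m n} → m ≤′ n → u m ≤∞ u n
  go ≤′-refl     = ≤∞-refl
  go (≤′-step h) = ≤∞-trans (go h) (ch _)

⨆-upper : ∀ u n → u n ≤∞ ⨆ u
⨆-upper u n = le (n ,_)

⨆-least : ∀ {u} → (∀ n → u n ≤∞ b) → ⨆ u ≤∞ b
⨆-least h = le λ (n , q) → below-mono (h n) q

⨆-mono : ∀ {u v} → (∀ n → u n ≤∞ v n) → ⨆ u ≤∞ ⨆ v
⨆-mono h = le λ (n , q) → n , below-mono (h n) q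

⨆-cong : ∀ {u v} → (∀ n → u n ≈∞ v n) → ⨆ u ≈∞ ⨆ v
⨆-cong h = ⨆-mono (proj₁ ∘ h) , ⨆-mono (proj₂ ∘ h)

⨆-+ : ∀ {u v} → Chain u → Chain v → ⨆ u +∞ ⨆ v ≤∞ ⨆ λ n → u n +∞ v n
⨆-+ chu chv = le λ (r , s , (m , hr) , (n , hs) , h) → m ⊔ⁿ n , r , s ,
  below-mono (chain-mono chu (ℕ.m≤m⊔n m n)) hr , below-mono (chain-mono chv (ℕ.m≤n⊔m m n)) hs , h

*-⨆ : ∀ {v} → a *∞ ⨆ v ≤∞ ⨆ λ n → a *∞ v n
*-⨆ = le λ
  { (inj₁ q<0) → 0 , inj₁ q<0
  ; (inj₂ (r , s , 0≤r , 0≤s , hr , (n , hs) , h)) → n , inj₂ (r , s , 0≤r , 0≤s , hr , hs , h)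
  }

-- A set with a family of basic subsets, carrying the σ-algebra they generate.
record MeasurableSpace (ℓ : Level) : Set (lsuc ℓ) where
  field
    Carrier : Set ℓ
    Basic   : Set
    _∈ᵇ_    : Carrier → Basic → Set

open MeasurableSpace

-- Codes for the members of the σ-algebra; codes with the same elements (_≐_)
-- denote the same event.
data Event {ℓ} (X : MeasurableSpace ℓ) : Set where
  basic : Basic X → Event X
  ∅     : Event X
  ∁_    : Event X → Event X
  ⋃     : (ℕ → Event X) → Event X

infix 4 _∈_ _∉_ _⊆_ _≐_
infixr 7 _∩_
infixr 6 _∪_
infix 8 ∁_

private
  variable
    ℓ ℓ′ : Level

_∈_ : {X : MeasurableSpace ℓ} → Carrier X → Event X → Set
_∈_ {X = X} x (basic g) = _∈ᵇ_ X x g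
x ∈ ∅                   = ⊥
x ∈ ∁ A                 = ¬ x ∈ A
x ∈ ⋃ A                 = ∃[ n ] x ∈ A n

_∉_ : {X : MeasurableSpace ℓ} → Carrier X → Event X → Set
x ∉ A = ¬ x ∈ A

_⊆_ : {X : MeasurableSpace ℓ} → Event X → Event X → Set ℓ
A ⊆ B = ∀ x → x ∈ A → x ∈ B

_≐_ : {X : MeasurableSpace ℓ} → Event X → Event X → Set ℓ
A ≐ B = A ⊆ B × B ⊆ A

Disjoint : {X : MeasurableSpace ℓ} → (ℕ → Event X) → Set ℓ
Disjoint A = ∀ m n → m ≢ n → ∀ x → x ∈ A m → x ∉ A n

full : {X : MeasurableSpace ℓ} → Event X
full = ∁ ∅

pair : {X : MeasurableSpace ℓ} → Event X → Event X → ℕ → Event X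
pair A B 0             = A
pair A B 1             = B
pair A B (suc (suc _)) = ∅

_∪_ _∩_ : {X : MeasurableSpace ℓ} → Event X → Event X → Event X
A ∪ B = ⋃ (pair A B)
A ∩ B = ∁ (∁ A ∪ ∁ B)

Measurable : (X : MeasurableSpace ℓ) (Y : MeasurableSpace ℓ′) → (Carrier X → Carrier Y) → Set ℓ
Measurable X Y f = (B : Event Y) → Σ[ A ∈ Event X ] (∀ x → x ∈ A ⇔ f x ∈ B)

-- Borel σ-algebra of ℝ, generated by the rays {x | x < q}
Borel : MeasurableSpace 0ℓ
Borel = record { Carrier = ℝ ; Basic = ℚ ; _∈ᵇ_ = _ʳ<_ }

-- Borel σ-algebra of [0,∞], generated by the rays {a | q < a}
Borel∞ : MeasurableSpace (lsuc 0ℓ)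
Borel∞ = record { Carrier = ℝ∞ ; Basic = ℚ ; _∈ᵇ_ = below }

record ProbabilityMeasure (X : MeasurableSpace 0ℓ) : Set₁ where
  field
    measure   : Event X → ℝ∞
    cong-≐    : ∀ {A B} → A ≐ B → measure A ≈∞ measure B
    empty     : measure ∅ ≈∞ 0∞
    additive  : ∀ A → Disjoint A → measure (⋃ A) ≈∞ ∑ (λ n → measure (A n))
    total     : measure full ≈∞ 1∞

open ProbabilityMeasure

-- Iverson bracket [x ∈ A]
𝟙 : {X : MeasurableSpace ℓ} → Event X → Carrier X → ℝ∞
below    (𝟙 A x) q = q < 0ℚ ⊎ (x ∈ A × q < 1ℚ)
negative (𝟙 A x) = inj₁
downward (𝟙 A x) p≤q (inj₁ q<0)         = inj₁ (ℚ.≤-<-trans p≤q q<0)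
downward (𝟙 A x) p≤q (inj₂ (x∈A , q<1)) = inj₂ (x∈A , ℚ.≤-<-trans p≤q q<1)
rounded  (𝟙 A x) (inj₁ q<0)             = rounded-negative q<0
rounded  (𝟙 A x) (inj₂ (x∈A , q<1))     = let r , q<r , r<1 = ℚ.<-dense q<1 in r , q<r , inj₂ (x∈A , r<1)

-- The list (c₁,B₁),…,(cₙ,Bₙ) stands for the simple function
-- c₁·[B₁] + … + cₙ·[Bₙ], negative coefficients being read as 0.  Rational
-- coefficients suffice for the supremum defining the integral.
Simple : MeasurableSpace ℓ → Set
Simple X = List (ℚ × Event X)

value : {X : MeasurableSpace ℓ} → Simple X → Carrier X → ℝ∞
value []            x = 0∞
value ((c , B) ∷ s) x = ι c *∞ 𝟙 B x +∞ value s x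

∫ˢ : {X : MeasurableSpace 0ℓ} → ProbabilityMeasure X → Simple X → ℝ∞
∫ˢ μ []            = 0∞
∫ˢ μ ((c , B) ∷ s) = ι c *∞ measure μ B +∞ ∫ˢ μ s

-- Lebesgue integral: the supremum of ∫ˢ over the simple functions below f
∫ : {X : MeasurableSpace 0ℓ} → ProbabilityMeasure X → (Carrier X → ℝ∞) → ℝ∞
below    (∫ μ f) q = ∃[ s ] (∀ x → value s x ≤∞ f x) × below (∫ˢ μ s) q
negative (∫ μ f) q<0 = [] , (λ x → 0≤∞) , inj₁ q<0
downward (∫ μ f) p≤q (s , s≤f , h) = s , s≤f , downward (∫ˢ μ s) p≤q h
rounded  (∫ μ f) (s , s≤f , h) = let r , q<r , h′ = rounded (∫ˢ μ s) h in r , q<r , s , s≤f , h′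

-- The proofs that expectations are closed under the semantics below, and that
-- loops have least fixed points, rest on this development.
module MeasureTheory (em : ExcludedMiddle 0ℓ) where

  dne : {P : Set} → ¬ ¬ P → P
  dne {P} h with em {P}
  ... | yes p = p
  ... | no ¬p = contradiction ¬p h

  module _ {ℓ} {X : MeasurableSpace ℓ} {A B : Event X} {x : Carrier X} where

    ∪⁺ : x ∈ A ⊎ x ∈ B → x ∈ A ∪ B
    ∪⁺ (inj₁ h) = 0 , h
    ∪⁺ (inj₂ h) = 1 , h

    ∪⁻ : x ∈ A ∪ B → x ∈ A ⊎ x ∈ B
    ∪⁻ (0 , h) = inj₁ h
    ∪⁻ (1 , h) = inj₂ h

  module _ {ℓ} {X : MeasurableSpace ℓ} {A B : Event X} {x : Carrier X} where

    ∩⁺ : x ∈ A → x ∈ B → x ∈ A ∩ B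
    ∩⁺ h k m with ∪⁻ {A = ∁ A} {∁ B} m
    ... | inj₁ ¬h = ¬h h
    ... | inj₂ ¬k = ¬k k

    ∩⁻ : x ∈ A ∩ B → x ∈ A × x ∈ B
    ∩⁻ m = dne (λ ¬h → m (0 , ¬h)) , dne (λ ¬k → m (1 , ¬k))

  module _ {ℓ} {X : MeasurableSpace ℓ} (A : Event X) {x : Carrier X} where

    𝟙≤1 : 𝟙 A x ≤∞ 1∞
    𝟙≤1 = le λ { (inj₁ h) → inj₁ h ; (inj₂ (_ , h)) → inj₂ h }

    1≤𝟙 : x ∈ A → 1∞ ≤∞ 𝟙 A x
    1≤𝟙 x∈A = le λ { (inj₁ h) → inj₁ h ; (inj₂ h) → inj₂ (x∈A , h) }

    𝟙≤0 : x ∉ A → 𝟙 A x ≤∞ 0∞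
    𝟙≤0 x∉A = le λ { (inj₁ h) → inj₁ h ; (inj₂ (h , _)) → contradiction h x∉A }

    𝟙*-≤ : 𝟙 A x *∞ a ≤∞ a
    𝟙*-≤ = ≤∞-trans (*-mono 𝟙≤1 ≤∞-refl) *-identityˡ-≤

    𝟙*-∈ : x ∈ A → a ≤∞ 𝟙 A x *∞ a
    𝟙*-∈ x∈A = ≤∞-trans *-identityˡ-≥ (*-mono (1≤𝟙 x∈A) ≤∞-refl)

    𝟙*-∉ : x ∉ A → 𝟙 A x *∞ a ≤∞ 0∞
    𝟙*-∉ x∉A = ≤∞-trans (*-mono (𝟙≤0 x∉A) ≤∞-refl) *-zeroˡ

  module _ {ℓ} {X : MeasurableSpace ℓ} where

    pair-disjoint : {A B : Event X} → (∀ x → x ∈ A → x ∉ B) → Disjoint (pair A B)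
    pair-disjoint d 0 0             m≢n x h k = m≢n refl
    pair-disjoint d 0 1             m≢n x h k = d x h k
    pair-disjoint d 1 0             m≢n x h k = d x k h
    pair-disjoint d 1 1             m≢n x h k = m≢n refl

    ∩-mono : {A B : Event X} (C : Event X) → A ⊆ B → A ∩ C ⊆ B ∩ C
    ∩-mono {A} {B} C A⊆B x m = let h , k = ∩⁻ {A = A} {C} m in ∩⁺ {A = B} {C} (A⊆B x h) k

    ∩-swap : (A B C : Event X) → (A ∩ B) ∩ C ⊆ (A ∩ C) ∩ B
    ∩-swap A B C x m = let h , hC = ∩⁻ {A = A ∩ B} {C} m; hA , hB = ∩⁻ {A = A} {B} h
                       in ∩⁺ {A = A ∩ C} {B} (∩⁺ {A = A} {C} hA hC) hB

    ∩-comm : (A B : Event X) → A ∩ B ⊆ B ∩ A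
    ∩-comm A B x m = let h , k = ∩⁻ {A = A} {B} m in ∩⁺ {A = B} {A} k h

  module _ {X : MeasurableSpace 0ℓ} (μ : ProbabilityMeasure X) where

    private
      variable
        A B R : Event X

    μ-∪ : (∀ x → x ∈ A → x ∉ B) → measure μ (A ∪ B) ≈∞ measure μ A +∞ measure μ B
    μ-∪ {A} {B} d = ≈∞-trans (additive μ (pair A B) (pair-disjoint d)) (⨆-least bound , le λ h → 2 , below-mono two h)
      where
      two : measure μ A +∞ measure μ B ≤∞ (0∞ +∞ measure μ A) +∞ measure μ B
      two = +-mono b≤a+b ≤∞-refl
      bound : ∀ n → ∑< n (λ n → measure μ (pair A B n)) ≤∞ measure μ A +∞ measure μ B
      bound 0                   = 0≤∞
      bound 1                   = ≤∞-trans (proj₁ +-identityˡ) a≤a+b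
      bound 2                   = +-mono (proj₁ +-identityˡ) ≤∞-refl
      bound (suc (suc (suc n))) = ≤∞-trans (+-mono (bound (suc (suc n))) (proj₁ (empty μ))) +-identityʳ-≤

    μ-split : ∀ R B → measure μ R ≈∞ measure μ (R ∩ B) +∞ measure μ (R ∩ ∁ B)
    μ-split R B = ≈∞-trans (cong-≐ μ (split , join))
      (μ-∪ λ x h k → proj₂ (∩⁻ {A = R} {∁ B} k) (proj₂ (∩⁻ {A = R} {B} h)))
      where
      split : R ⊆ R ∩ B ∪ R ∩ ∁ B
      split x h with em {x ∈ B}
      ... | yes x∈B = 0 , ∩⁺ {A = R} {B} h x∈B
      ... | no  x∉B = 1 , ∩⁺ {A = R} {∁ B} h x∉B
      join : R ∩ B ∪ R ∩ ∁ B ⊆ R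
      join x (0 , h) = proj₁ (∩⁻ {A = R} {B} h)
      join x (1 , h) = proj₁ (∩⁻ {A = R} {∁ B} h)

    μ-mono : A ⊆ B → measure μ A ≤∞ measure μ B
    μ-mono {A} {B} A⊆B = ≤∞-trans a≤a+b (≤∞-trans
      (+-mono (proj₁ (cong-≐ μ ((λ x h → ∩⁺ {A = B} {A} (A⊆B x h) h) , (λ x h → proj₂ (∩⁻ {A = B} {A} h))))) ≤∞-refl)
      (proj₂ (μ-split B A)))

  module _ {ℓ} {X : MeasurableSpace ℓ} (A : ℕ → Event X) where

    before : ℕ → Event X
    before zero    = ∅
    before (suc n) = before n ∪ A n

    fresh : ℕ → Event X
    fresh n = A n ∩ ∁ before n

    before-suc : ∀ n → before n ⊆ before (suc n)
    before-suc n x = 0 ,_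

    before-mono : ∀ {m n} → m <ⁿ n → A m ⊆ before n
    before-mono {m} {suc n} m<sn x h with ℕ.m≤n⇒m<n∨m≡n (ℕ.≤-pred m<sn)
    ... | inj₁ m<n  = 0 , before-mono m<n x h
    ... | inj₂ refl = 1 , h

    fresh-disjoint : Disjoint fresh
    fresh-disjoint m n m≢n x h k
      with hA , h∁ ← ∩⁻ {A = A m} {∁ before m} h | kA , k∁ ← ∩⁻ {A = A n} {∁ before n} k
      with ℕ.<-cmp m n
    ... | tri< m<n _ _ = k∁ (before-mono m<n x hA)
    ... | tri≈ _ m≡n _ = m≢n m≡n
    ... | tri> _ _ n<m = h∁ (before-mono n<m x kA)

    before⇒fresh : ∀ n x → x ∈ before n → ∃[ k ] x ∈ fresh k
    before⇒fresh (suc n) x (0 , h) = before⇒fresh n x h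
    before⇒fresh (suc n) x (1 , h) with em {x ∈ before n}
    ... | yes p = before⇒fresh n x p
    ... | no ¬p = n , ∩⁺ {A = A n} {∁ before n} h ¬p

    ⋃-fresh : ⋃ A ≐ ⋃ fresh
    ⋃-fresh = (λ x (n , h) → before⇒fresh (suc n) x (1 , h)) ,
              (λ x (n , h) → n , proj₁ (∩⁻ {A = A n} {∁ before n} h))

  module _ {X : MeasurableSpace 0ℓ} (μ : ProbabilityMeasure X) (A : ℕ → Event X) where

    ∑<-fresh : ∀ n → ∑< n (λ k → measure μ (fresh A k)) ≤∞ measure μ (before A n)
    ∑<-fresh zero    = 0≤∞
    ∑<-fresh (suc n) = ≤∞-trans (+-mono (∑<-fresh n) ≤∞-refl) (≤∞-trans
      (proj₂ (μ-∪ μ (λ x h k → proj₂ (∩⁻ {A = A n} {∁ before A n} k) h)))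
      (μ-mono μ λ { x (0 , h) → 0 , h ; x (1 , h) → 1 , proj₁ (∩⁻ {A = A n} {∁ before A n} h) }))

    continuous-from-below : (∀ n → A n ⊆ A (suc n)) → measure μ (⋃ A) ≤∞ ⨆ λ n → measure μ (A n)
    continuous-from-below incr = ≤∞-trans (proj₁ (cong-≐ μ (⋃-fresh A)))
      (≤∞-trans (proj₁ (additive μ (fresh A) (fresh-disjoint A)))
        (⨆-least λ n → ≤∞-trans (∑<-fresh n) (≤∞-trans (μ-mono μ (before⊆ n)) (⨆-upper _ n))))
      where
      before⊆ : ∀ n → before A n ⊆ A n
      before⊆ (suc n) x (0 , h) = incr n x (before⊆ n x h)
      before⊆ (suc n) x (1 , h) = incr n x h

  module _ {X : MeasurableSpace 0ℓ} (μ : ProbabilityMeasure X) where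

    private
      variable
        f g : Carrier X → ℝ∞

    ∫-mono : (∀ x → f x ≤∞ g x) → ∫ μ f ≤∞ ∫ μ g
    ∫-mono f≤g = le λ (s , s≤f , h) → s , (λ x → ≤∞-trans (s≤f x) (f≤g x)) , h

    value-++ : ∀ (s t : Simple X) x → value (s ++ t) x ≤∞ value s x +∞ value t x
    value-++ []            t x = b≤a+b
    value-++ ((c , B) ∷ s) t x = ≤∞-trans (+-mono ≤∞-refl (value-++ s t x)) (+-assoc-≥ _ _ _)

    ∫ˢ-++ : ∀ (s t : Simple X) → ∫ˢ μ s +∞ ∫ˢ μ t ≤∞ ∫ˢ μ (s ++ t)
    ∫ˢ-++ []            t = proj₁ +-identityˡ
    ∫ˢ-++ ((c , B) ∷ s) t = ≤∞-trans (+-assoc-≤ _ _ _) (+-mono ≤∞-refl (∫ˢ-++ s t))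

    ∫-+ : ∀ f g → ∫ μ f +∞ ∫ μ g ≤∞ ∫ μ (λ x → f x +∞ g x)
    ∫-+ f g = le λ (p , q , (s , s≤f , hs) , (t , t≤g , ht) , h) →
      s ++ t , (λ x → ≤∞-trans (value-++ s t x) (+-mono (s≤f x) (t≤g x))) ,
      below-mono (∫ˢ-++ s t) (p , q , hs , ht , h)

    ∫[_] : Event X → (Carrier X → ℝ∞) → ℝ∞
    ∫[ R ] f = ∫ μ (λ x → 𝟙 R x *∞ f x)

    ∫[full]-≤ : ∫[ full ] f ≤∞ ∫ μ f
    ∫[full]-≤ = ∫-mono (λ x → 𝟙*-≤ full)

    ∫[]-split : ∀ f R B → ∫[ R ∩ B ] f +∞ ∫[ R ∩ ∁ B ] f ≤∞ ∫[ R ] f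
    ∫[]-split f R B = ≤∞-trans (∫-+ _ _) (∫-mono pointwise)
      where
      pointwise : ∀ x → 𝟙 (R ∩ B) x *∞ f x +∞ 𝟙 (R ∩ ∁ B) x *∞ f x ≤∞ 𝟙 R x *∞ f x
      pointwise x with em {x ∈ R ∩ B} | em {x ∈ R ∩ ∁ B}
      ... | yes h | yes k = contradiction (proj₂ (∩⁻ {A = R} {B} h)) (proj₂ (∩⁻ {A = R} {∁ B} k))
      ... | yes h | no ¬k = ≤∞-trans (+-mono (𝟙*-≤ (R ∩ B)) (𝟙*-∉ (R ∩ ∁ B) ¬k))
                              (≤∞-trans +-identityʳ-≤ (𝟙*-∈ R (proj₁ (∩⁻ {A = R} {B} h))))
      ... | no ¬h | yes k = ≤∞-trans (+-mono (𝟙*-∉ (R ∩ B) ¬h) (𝟙*-≤ (R ∩ ∁ B)))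
                              (≤∞-trans (proj₁ +-identityˡ) (𝟙*-∈ R (proj₁ (∩⁻ {A = R} {∁ B} k))))
      ... | no ¬h | no ¬k = ≤∞-trans (+-mono (𝟙*-∉ (R ∩ B) ¬h) (𝟙*-∉ (R ∩ ∁ B) ¬k))
                              (≤∞-trans +-identityʳ-≤ 0≤∞)

    rectangle : ∀ q R S → S ⊆ R → (∀ x → x ∈ S → ι q ≤∞ f x) → ι q *∞ measure μ S ≤∞ ∫[ R ] f
    rectangle {f} q R S S⊆R q≤f = le λ h → (q , S) ∷ [] , simple≤ , below-mono (a≤a+b {ι q *∞ measure μ S} {0∞}) h
      where
      simple≤ : ∀ x → ι q *∞ 𝟙 S x +∞ 0∞ ≤∞ 𝟙 R x *∞ f x
      simple≤ x with em {x ∈ S}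
      ... | yes x∈S = ≤∞-trans +-identityʳ-≤ (≤∞-trans (*-comm _ _) (≤∞-trans (𝟙*-≤ S)
                        (≤∞-trans (q≤f x x∈S) (𝟙*-∈ R (S⊆R x x∈S)))))
      ... | no  x∉S = ≤∞-trans +-identityʳ-≤ (≤∞-trans (*-comm _ _) (≤∞-trans (𝟙*-∉ S x∉S) 0≤∞))

    -- A superadditive set function dominating v·μ(R) whenever f ≥ v on R
    -- dominates the integral of f.
    module Domination (f : Carrier X → ℝ∞) (K : Event X → ℝ∞)
      (superadditive : ∀ R B → K (R ∩ B) +∞ K (R ∩ ∁ B) ≤∞ K R)
      (dominates : ∀ R v → (∀ x → x ∈ R → v ≤∞ f x) → v *∞ measure μ R ≤∞ K R) where

      on : Event X → Simple X → ℝ∞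
      on R []            = 0∞
      on R ((c , B) ∷ s) = ι c *∞ measure μ (R ∩ B) +∞ on R s

      on-split : ∀ R B s → on R s ≤∞ on (R ∩ B) s +∞ on (R ∩ ∁ B) s
      on-split R B []            = proj₂ +-identityˡ
      on-split R B ((c , D) ∷ s) = ≤∞-trans (+-mono head (on-split R B s)) (interchange _ _ _ _)
        where
        head : ι c *∞ measure μ (R ∩ D) ≤∞ ι c *∞ measure μ ((R ∩ B) ∩ D) +∞ ι c *∞ measure μ ((R ∩ ∁ B) ∩ D)
        head = ≤∞-trans (*-mono ≤∞-refl (≤∞-trans (proj₁ (μ-split μ (R ∩ D) B))
                 (+-mono (μ-mono μ (∩-swap R D B)) (μ-mono μ (∩-swap R D (∁ B)))))) (*-distribˡ-≤ _ _ _)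

      atoms : ∀ s R v → (∀ x → x ∈ R → v +∞ value s x ≤∞ f x) → v *∞ measure μ R +∞ on R s ≤∞ K R
      atoms []            R v h = ≤∞-trans +-identityʳ-≤ (dominates R v λ x x∈R → ≤∞-trans a≤a+b (h x x∈R))
      atoms ((c , B) ∷ s) R v h =
        ≤∞-trans (+-mono
          (≤∞-trans (*-mono ≤∞-refl (proj₁ (μ-split μ R B))) (*-distribˡ-≤ _ _ _))
          (≤∞-trans (+-mono ≤∞-refl (on-split R B s)) (+-assoc-≥ _ _ _)))
        (≤∞-trans (interchange _ _ _ _)
        (≤∞-trans (+-mono
          (≤∞-trans (+-assoc-≥ _ _ _) (≤∞-trans (+-mono (*-distribʳ-≥ v (ι c) _) ≤∞-refl)
            (atoms s (R ∩ B) (v +∞ ι c) inside)))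
          (atoms s (R ∩ ∁ B) v outside))
        (superadditive R B)))
        where
        inside : ∀ x → x ∈ R ∩ B → (v +∞ ι c) +∞ value s x ≤∞ f x
        inside x m = let x∈R , x∈B = ∩⁻ {A = R} {B} m in ≤∞-trans (+-assoc-≤ _ _ _)
          (≤∞-trans (+-mono ≤∞-refl (+-mono (≤∞-trans (𝟙*-∈ B x∈B) (*-comm _ _)) ≤∞-refl)) (h x x∈R))
        outside : ∀ x → x ∈ R ∩ ∁ B → v +∞ value s x ≤∞ f x
        outside x m = ≤∞-trans (+-mono ≤∞-refl b≤a+b) (h x (proj₁ (∩⁻ {A = R} {∁ B} m)))

      ∫ˢ≤on : ∀ s → ∫ˢ μ s ≤∞ on full s
      ∫ˢ≤on []            = ≤∞-refl
      ∫ˢ≤on ((c , B) ∷ s) = +-mono (*-mono ≤∞-refl (μ-mono μ λ x h → ∩⁺ {A = full} {B} id h)) (∫ˢ≤on s)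

      ∫≤K : ∫ μ f ≤∞ K full
      ∫≤K = le λ (s , s≤f , h) → below-mono (≤∞-trans (∫ˢ≤on s) (≤∞-trans b≤a+b
        (atoms s full 0∞ λ x _ → ≤∞-trans (proj₁ +-identityˡ) (s≤f x)))) h

    monotone-convergence : (f : ℕ → Carrier X → ℝ∞) → (∀ x → Chain λ n → f n x) →
      (F : ℕ → ℚ → Event X) → (∀ n q x → x ∈ F n q ⇔ below (f n x) q) →
      ∫ μ (λ x → ⨆ λ n → f n x) ≤∞ ⨆ λ n → ∫ μ (f n)
    monotone-convergence f chain F F-spec = ≤∞-trans ∫≤K (⨆-mono λ n → ∫[full]-≤)
      where
      chain-∫ : ∀ R → Chain λ n → ∫[ R ] (f n)
      chain-∫ R n = ∫-mono λ x → *-mono ≤∞-refl (chain x n)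
      limit : Carrier X → ℝ∞
      limit x = ⨆ λ n → f n x
      ∫-limit : Event X → ℝ∞
      ∫-limit R = ⨆ λ n → ∫[ R ] (f n)
      superadditive : ∀ R B → ∫-limit (R ∩ B) +∞ ∫-limit (R ∩ ∁ B) ≤∞ ∫-limit R
      superadditive R B = ≤∞-trans (⨆-+ (chain-∫ (R ∩ B)) (chain-∫ (R ∩ ∁ B))) (⨆-mono λ n → ∫[]-split (f n) R B)
      dominates : ∀ R v → (∀ x → x ∈ R → v ≤∞ limit x) → v *∞ measure μ R ≤∞ ∫-limit R
      dominates R v v≤f = le λ
        { (inj₁ q<0) → 0 , negative (∫[ R ] (f 0)) q<0
        ; (inj₂ (r , s , 0≤r , 0≤s , hr , hs , h)) →
            let r′ , r<r′ , hr′ = rounded v hr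
                S : ℕ → Event X
                S n = R ∩ F n r′
                n , hs′ = below-mono (≤∞-trans
                  (μ-mono μ {A = R} {⋃ S} λ x x∈R →
                    let n , k = below-mono (v≤f x x∈R) hr′
                    in n , ∩⁺ {A = R} {F n r′} x∈R (from (F-spec n r′ x) k))
                  (continuous-from-below μ S λ n x m →
                    let x∈R , x∈F = ∩⁻ {A = R} {F n r′} m
                    in ∩⁺ {A = R} {F (suc n) r′} x∈R
                         (from (F-spec (suc n) r′ x) (below-mono (chain x n) (to (F-spec n r′ x) x∈F))))) hs
            in n , below-mono
                 (rectangle r′ R (S n) (λ x → proj₁ ∘ ∩⁻ {A = R} {F n r′})
                   (λ x → ι-≤ ∘ to (F-spec n r′ x) ∘ proj₂ ∘ ∩⁻ {A = R} {F n r′}))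
                 (inj₂ (r , s , 0≤r , 0≤s , inj₂ r<r′ , hs′ , h))
        }
      open Domination limit ∫-limit superadditive dominates

    -- The integral as a supremum over the finite sets of rational
    -- thresholds, each splitting the space along the events {q < f}.
    module Thresholds (f : Carrier X → ℝ∞) (F : ℚ → Event X) (F-spec : ∀ q x → x ∈ F q ⇔ below (f x) q) where

      steps : List ℚ → Event X → ℚ → ℝ∞
      steps []      R v = ι v *∞ measure μ R
      steps (r ∷ L) R v = steps L (R ∩ F r) (v ⊔ r) +∞ steps L (R ∩ ∁ F r) v

      steps-mono : ∀ L {R S v w} → R ⊆ S → v ≤ w → steps L R v ≤∞ steps L S w
      steps-mono []      R⊆S v≤w = *-mono (ι-mono v≤w) (μ-mono μ R⊆S)
      steps-mono (r ∷ L) R⊆S v≤w = +-mono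
        (steps-mono L (∩-mono (F r) R⊆S) (ℚ.⊔-mono-≤ v≤w ℚ.≤-refl))
        (steps-mono L (∩-mono (∁ F r) R⊆S) v≤w)

      steps-lower : ∀ L R v → ι v *∞ measure μ R ≤∞ steps L R v
      steps-lower []      R v = ≤∞-refl
      steps-lower (r ∷ L) R v = ≤∞-trans (*-mono ≤∞-refl (proj₁ (μ-split μ R (F r))))
        (≤∞-trans (*-distribˡ-≤ _ _ _) (+-mono
          (≤∞-trans (*-mono (ι-mono (ℚ.p≤p⊔q v r)) ≤∞-refl) (steps-lower L (R ∩ F r) (v ⊔ r)))
          (steps-lower L (R ∩ ∁ F r) v)))

      steps-split-≥ : ∀ L R B v → steps L (R ∩ B) v +∞ steps L (R ∩ ∁ B) v ≤∞ steps L R v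
      steps-split-≥ []      R B v = ≤∞-trans (*-distribˡ-≥ _ _ _) (*-mono ≤∞-refl (proj₂ (μ-split μ R B)))
      steps-split-≥ (r ∷ L) R B v = ≤∞-trans (interchange _ _ _ _) (+-mono
        (≤∞-trans (+-mono (steps-mono L (∩-swap R B (F r)) ℚ.≤-refl) (steps-mono L (∩-swap R (∁ B) (F r)) ℚ.≤-refl))
          (steps-split-≥ L (R ∩ F r) B (v ⊔ r)))
        (≤∞-trans (+-mono (steps-mono L (∩-swap R B (∁ F r)) ℚ.≤-refl) (steps-mono L (∩-swap R (∁ B) (∁ F r)) ℚ.≤-refl))
          (steps-split-≥ L (R ∩ ∁ F r) B v)))

      steps-split-≤ : ∀ L R B v → steps L R v ≤∞ steps L (R ∩ B) v +∞ steps L (R ∩ ∁ B) v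
      steps-split-≤ []      R B v = ≤∞-trans (*-mono ≤∞-refl (proj₁ (μ-split μ R B))) (*-distribˡ-≤ _ _ _)
      steps-split-≤ (r ∷ L) R B v = ≤∞-trans (+-mono
        (≤∞-trans (steps-split-≤ L (R ∩ F r) B (v ⊔ r))
          (+-mono (steps-mono L (∩-swap R (F r) B) ℚ.≤-refl) (steps-mono L (∩-swap R (F r) (∁ B)) ℚ.≤-refl)))
        (≤∞-trans (steps-split-≤ L (R ∩ ∁ F r) B v)
          (+-mono (steps-mono L (∩-swap R (∁ F r) B) ℚ.≤-refl) (steps-mono L (∩-swap R (∁ F r) (∁ B)) ℚ.≤-refl))))
        (interchange _ _ _ _)

      steps-++ˡ : ∀ L L′ R v → steps L R v ≤∞ steps (L ++ L′) R v
      steps-++ˡ []      L′ R v = steps-lower L′ R v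
      steps-++ˡ (r ∷ L) L′ R v = +-mono (steps-++ˡ L L′ (R ∩ F r) (v ⊔ r)) (steps-++ˡ L L′ (R ∩ ∁ F r) v)

      steps-++ʳ : ∀ L L′ R v → steps L′ R v ≤∞ steps (L ++ L′) R v
      steps-++ʳ []      L′ R v = ≤∞-refl
      steps-++ʳ (r ∷ L) L′ R v = ≤∞-trans (steps-split-≤ L′ R (F r) v) (+-mono
        (≤∞-trans (steps-mono L′ (λ _ → id) (ℚ.p≤p⊔q v r)) (steps-++ʳ L L′ (R ∩ F r) (v ⊔ r)))
        (steps-++ʳ L L′ (R ∩ ∁ F r) v))

      steps≤∫ : ∀ L R v → (∀ x → x ∈ R → ι v ≤∞ f x) → steps L R v ≤∞ ∫[ R ] f
      steps≤∫ []      R v h = rectangle v R R (λ _ → id) h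
      steps≤∫ (r ∷ L) R v h = ≤∞-trans (+-mono
        (steps≤∫ L (R ∩ F r) (v ⊔ r) inside)
        (steps≤∫ L (R ∩ ∁ F r) v (λ x → h x ∘ proj₁ ∘ ∩⁻ {A = R} {∁ F r})))
        (∫[]-split f R (F r))
        where
        inside : ∀ x → x ∈ R ∩ F r → ι (v ⊔ r) ≤∞ f x
        inside x m with hR , hF ← ∩⁻ {A = R} {F r} m | ℚ.⊔-sel v r
        ... | inj₁ e = subst (λ w → ι w ≤∞ f x) (sym e) (h x hR)
        ... | inj₂ e = subst (λ w → ι w ≤∞ f x) (sym e) (ι-≤ (to (F-spec r x) hF))

      sup-steps : Event X → ℝ∞
      below    (sup-steps R) q = ∃[ L ] below (steps L R 0ℚ) q
      negative (sup-steps R) q<0 = [] , negative (steps [] R 0ℚ) q<0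
      downward (sup-steps R) p≤q (L , h) = L , downward (steps L R 0ℚ) p≤q h
      rounded  (sup-steps R) (L , h) = let r , q<r , h′ = rounded (steps L R 0ℚ) h in r , q<r , L , h′

      ∫≈sup-steps : ∫ μ f ≈∞ sup-steps full
      ∫≈sup-steps = ∫≤K , le λ (L , h) →
        below-mono (≤∞-trans (steps≤∫ L full 0ℚ (λ _ _ → 0≤∞)) ∫[full]-≤) h
        where
        superadditive : ∀ R B → sup-steps (R ∩ B) +∞ sup-steps (R ∩ ∁ B) ≤∞ sup-steps R
        superadditive R B = le λ (p , q , (L , hL) , (L′ , hL′) , h) → L ++ L′ ,
          below-mono (steps-split-≥ (L ++ L′) R B 0ℚ)
            (p , q , below-mono (steps-++ˡ L L′ (R ∩ B) 0ℚ) hL , below-mono (steps-++ʳ L L′ (R ∩ ∁ B) 0ℚ) hL′ , h)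
        dominates : ∀ R v → (∀ x → x ∈ R → v ≤∞ f x) → v *∞ measure μ R ≤∞ sup-steps R
        dominates R v v≤f = le λ
          { (inj₁ q<0) → [] , inj₁ q<0
          ; (inj₂ (r , s , 0≤r , 0≤s , hr , hs , h)) →
              let r′ , r<r′ , hr′ = rounded v hr
              in r′ ∷ [] , below-mono (a≤a+b {steps [] (R ∩ F r′) (0ℚ ⊔ r′)} {steps [] (R ∩ ∁ F r′) 0ℚ}) (inj₂ (r , s , 0≤r , 0≤s ,
                   inj₂ (ℚ.<-≤-trans r<r′ (ℚ.p≤q⊔p 0ℚ r′)) ,
                   below-mono (μ-mono μ {A = R} {R ∩ F r′} λ x x∈R →
                     ∩⁺ {A = R} {F r′} x∈R (from (F-spec r′ x) (below-mono (v≤f x x∈R) hr′))) hs , h))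
          }
        open Domination f sup-steps superadditive dominates

  MeasurableSet : (X : MeasurableSpace ℓ) → (Carrier X → Set) → Set ℓ
  MeasurableSet X P = Σ[ A ∈ Event X ] (∀ x → x ∈ A ⇔ P x)

  module _ {ℓ} {X : MeasurableSpace ℓ} where

    private
      variable
        P Q : Carrier X → Set

    set-ext : (∀ x → P x ⇔ Q x) → MeasurableSet X P → MeasurableSet X Q
    set-ext P⇔Q (A , h) = A , λ x → mk⇔ (to (P⇔Q x) ∘ to (h x)) (from (h x) ∘ from (P⇔Q x))

    set-const : ∀ S → MeasurableSet X (λ _ → S)
    set-const S with em {S}
    ... | yes s = full , λ x → mk⇔ (λ _ → s) (λ _ → id)
    ... | no ¬s = ∅ , λ x → mk⇔ (λ ()) (λ s → contradiction s ¬s)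

    set-¬ : MeasurableSet X P → MeasurableSet X (λ x → ¬ P x)
    set-¬ (A , h) = ∁ A , λ x → mk⇔ (_∘ from (h x)) (_∘ to (h x))

    set-⊎ : MeasurableSet X P → MeasurableSet X Q → MeasurableSet X (λ x → P x ⊎ Q x)
    set-⊎ (A , h) (B , k) = A ∪ B , λ x → mk⇔
      ([ inj₁ ∘ to (h x) , inj₂ ∘ to (k x) ] ∘ ∪⁻ {A = A} {B})
      (∪⁺ {A = A} {B} ∘ [ inj₁ ∘ from (h x) , inj₂ ∘ from (k x) ])

    set-× : MeasurableSet X P → MeasurableSet X Q → MeasurableSet X (λ x → P x × Q x)
    set-× (A , h) (B , k) = A ∩ B , λ x → mk⇔
      (λ m → let hA , hB = ∩⁻ {A = A} {B} m in to (h x) hA , to (k x) hB)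
      (λ (p , q) → ∩⁺ {A = A} {B} (from (h x) p) (from (k x) q))

    set-∃ℕ : {P : ℕ → Carrier X → Set} → (∀ n → MeasurableSet X (P n)) → MeasurableSet X (λ x → ∃[ n ] P n x)
    set-∃ℕ h = ⋃ (proj₁ ∘ h) , λ x → mk⇔ (λ (n , m) → n , to (proj₂ (h n) x) m) (λ (n , p) → n , from (proj₂ (h n) x) p)

    set-∃ℚ : {P : ℚ → Carrier X → Set} → (∀ q → MeasurableSet X (P q)) → MeasurableSet X (λ x → ∃[ q ] P q x)
    set-∃ℚ {P} h = set-ext (λ x → mk⇔ forget (enumerate x))
      (set-∃ℕ λ n → set-∃ℕ λ d → set-⊎ (h (pos n / suc d)) (h (-[1+ n ] / suc d)))
      where
      forget : ∀ {x} → ∃[ n ] ∃[ d ] (P (pos n / suc d) x ⊎ P (-[1+ n ] / suc d) x) → ∃[ q ] P q x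
      forget (n , d , inj₁ p) = _ , p
      forget (n , d , inj₂ p) = _ , p
      enumerate : ∀ x → ∃[ q ] P q x → ∃[ n ] ∃[ d ] (P (pos n / suc d) x ⊎ P (-[1+ n ] / suc d) x)
      enumerate x (q , p) with ↥ q | ℚ.↥p/↧p≡p q
      ... | pos n    | e = n , _ , inj₁ (subst (λ r → P r x) (sym e) p)
      ... | -[1+ n ] | e = n , _ , inj₂ (subst (λ r → P r x) (sym e) p)

    set-∃List : {P : List ℚ → Carrier X → Set} → (∀ L → MeasurableSet X (P L)) → MeasurableSet X (λ x → ∃[ L ] P L x)
    set-∃List {P} h = set-ext (λ x → mk⇔ (λ (n , p) → ofLength⁻ {P} n p) (λ (L , p) → length L , ofLength⁺ {P} L p)) (set-∃ℕ (set-ofLength {P} h))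
      where
      OfLength : ℕ → (List ℚ → Carrier X → Set) → Carrier X → Set
      OfLength zero    P x = P [] x
      OfLength (suc n) P x = ∃[ q ] OfLength n (λ L → P (q ∷ L)) x
      ofLength⁻ : ∀ {P : List ℚ → Carrier X → Set} n {x} → OfLength n P x → ∃[ L ] P L x
      ofLength⁻ zero    p       = [] , p
      ofLength⁻ {P} (suc n) (q , p) = let L , p′ = ofLength⁻ {λ L → P (q ∷ L)} n p in q ∷ L , p′
      ofLength⁺ : ∀ {P : List ℚ → Carrier X → Set} L {x} → P L x → OfLength (length L) P x
      ofLength⁺ []      p = p
      ofLength⁺ {P} (q ∷ L) p = q , ofLength⁺ {λ L → P (q ∷ L)} L p
      set-ofLength : ∀ {P : List ℚ → Carrier X → Set} → (∀ L → MeasurableSet X (P L)) → ∀ n → MeasurableSet X (OfLength n P)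
      set-ofLength h zero    = h []
      set-ofLength {P = P} h (suc n) = set-∃ℚ λ q → set-ofLength {λ L → P (q ∷ L)} (λ L → h (q ∷ L)) n

    -- The preimages of a generating family suffice.
    fromBasic : {Y : MeasurableSpace ℓ′} {f : Carrier X → Carrier Y} →
                (∀ b → MeasurableSet X (λ x → _∈ᵇ_ Y (f x) b)) → Measurable X Y f
    fromBasic h (basic b) = h b
    fromBasic h ∅         = ∅ , λ x → mk⇔ id id
    fromBasic h (∁ A)     = ∁ proj₁ (fromBasic h A) ,
      λ x → mk⇔ (_∘ from (proj₂ (fromBasic h A) x)) (_∘ to (proj₂ (fromBasic h A) x))
    fromBasic h (⋃ A)     = set-∃ℕ (λ n → fromBasic h (A n))

    Rays : (Carrier X → ℝ∞) → Set ℓ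
    Rays f = ∀ q → MeasurableSet X (λ x → below (f x) q)

    private
      variable
        f g : Carrier X → ℝ∞

    rays-ext : (∀ x → f x ≈∞ g x) → Rays f → Rays g
    rays-ext f≈g h q = set-ext (λ x → mk⇔ (below-mono (proj₁ (f≈g x))) (below-mono (proj₂ (f≈g x)))) (h q)

    rays-const : ∀ a → Rays (λ _ → a)
    rays-const a q = set-const (below a q)

    rays-𝟙 : ∀ A → Rays (𝟙 A)
    rays-𝟙 A q = set-⊎ (set-const (q < 0ℚ)) (set-× (A , λ x → mk⇔ id id) (set-const (q < 1ℚ)))

    rays-+ : Rays f → Rays g → Rays (λ x → f x +∞ g x)
    rays-+ h k q = set-∃ℚ λ r → set-∃ℚ λ s → set-× (h r) (set-× (k s) (set-const (q ≤ r + s)))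

    rays-* : Rays f → Rays g → Rays (λ x → f x *∞ g x)
    rays-* h k q = set-⊎ (set-const (q < 0ℚ)) (set-∃ℚ λ r → set-∃ℚ λ s →
      set-× (set-const (0ℚ ≤ r)) (set-× (set-const (0ℚ ≤ s)) (set-× (h r) (set-× (k s) (set-const (q ≤ r * s))))))

    rays-⨆ : {u : ℕ → Carrier X → ℝ∞} → (∀ n → Rays (u n)) → Rays (λ x → ⨆ λ n → u n x)
    rays-⨆ h q = set-∃ℕ λ n → h n q

    rays-∑< : {u : ℕ → Carrier X → ℝ∞} → (∀ n → Rays (u n)) → ∀ n → Rays (λ x → ∑< n λ k → u k x)
    rays-∑< h zero    = rays-const 0∞
    rays-∑< {u} h (suc n) = rays-+ {f = λ x → ∑< n λ k → u k x} {g = u n} (rays-∑< {u} h n) (h n)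

  -- The π-λ theorem, for the π-system of finite intersections of basic sets

  module _ {ℓ} {X : MeasurableSpace ℓ} where

    ⋂ : List (Basic X) → Event X
    ⋂ []       = full
    ⋂ (b ∷ bs) = basic b ∩ ⋂ bs

    data Λ : Event X → Set ℓ where
      Λ-⋂   : ∀ bs → Λ (⋂ bs)
      Λ-∁   : ∀ {A} → Λ A → Λ (∁ A)
      Λ-⋃   : ∀ {A} → Disjoint A → (∀ n → Λ (A n)) → Λ (⋃ A)
      Λ-ext : ∀ {A B} → A ≐ B → Λ A → Λ B

    private
      variable
        A B C : Event X

    Λ-∅ : Λ ∅
    Λ-∅ = Λ-ext ((λ x h → h id) , (λ x ())) (Λ-∁ (Λ-⋂ []))

    Λ-⊎ : (∀ x → x ∈ A → x ∉ B) → Λ A → Λ B → Λ (A ∪ B)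
    Λ-⊎ {A} {B} d hA hB = Λ-⋃ (pair-disjoint d) λ { 0 → hA ; 1 → hB ; (suc (suc n)) → Λ-∅ }

    -- (∁A) ∩ C is the complement of the disjoint union of A ∩ C and ∁C.
    Λ-∁∩ : Λ C → Λ (A ∩ C) → Λ (∁ A ∩ C)
    Λ-∁∩ {C} {A} hC hAC = Λ-ext (forth , back)
      (Λ-∁ (Λ-⊎ (λ x m ¬c → ¬c (proj₂ (∩⁻ {A = A} {C} m))) hAC (Λ-∁ hC)))
      where
      forth : ∁ (A ∩ C ∪ ∁ C) ⊆ ∁ A ∩ C
      forth x m = let c = dne (λ ¬c → m (1 , ¬c)) in
        ∩⁺ {A = ∁ A} {C} (λ a → m (0 , ∩⁺ {A = A} {C} a c)) c
      back : ∁ A ∩ C ⊆ ∁ (A ∩ C ∪ ∁ C)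
      back x m (0 , h) = proj₁ (∩⁻ {A = ∁ A} {C} m) (proj₁ (∩⁻ {A = A} {C} h))
      back x m (1 , h) = h (proj₂ (∩⁻ {A = ∁ A} {C} m))

    Λ-∩-from : Λ C → (∀ bs → Λ (⋂ bs ∩ C)) → Λ A → Λ (A ∩ C)
    Λ-∩-from hC base (Λ-⋂ bs)  = base bs
    Λ-∩-from hC base (Λ-∁ h)   = Λ-∁∩ hC (Λ-∩-from hC base h)
    Λ-∩-from {C} hC base (Λ-⋃ {A} d h) = Λ-ext
      ( (λ x (n , m) → let a , c = ∩⁻ {A = A n} {C} m in ∩⁺ {A = ⋃ A} {C} (n , a) c)
      , (λ x m → let (n , a) , c = ∩⁻ {A = ⋃ A} {C} m in n , ∩⁺ {A = A n} {C} a c) )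
      (Λ-⋃ {A = λ n → A n ∩ C}
        (λ m n m≢n x h k → d m n m≢n x (proj₁ (∩⁻ {A = A m} {C} h)) (proj₁ (∩⁻ {A = A n} {C} k)))
        (λ n → Λ-∩-from hC base (h n)))
    Λ-∩-from {C} hC base (Λ-ext {A} {B} (A⊆B , B⊆A) h) =
      Λ-ext (∩-mono {A = A} {B} C A⊆B , ∩-mono {A = B} {A} C B⊆A) (Λ-∩-from hC base h)

    ⋂-++ : ∀ bs cs → ⋂ (bs ++ cs) ≐ ⋂ bs ∩ ⋂ cs
    ⋂-++ bs cs = split bs , join bs
      where
      split : ∀ bs → ⋂ (bs ++ cs) ⊆ ⋂ bs ∩ ⋂ cs
      split []       x h = ∩⁺ {A = full} {⋂ cs} id h
      split (b ∷ bs) x h =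
        let hb , h′ = ∩⁻ {A = basic b} {⋂ (bs ++ cs)} h
            hbs , hcs = ∩⁻ {A = ⋂ bs} {⋂ cs} (split bs x h′)
        in ∩⁺ {A = ⋂ (b ∷ bs)} {⋂ cs} (∩⁺ {A = basic b} {⋂ bs} hb hbs) hcs
      join : ∀ bs → ⋂ bs ∩ ⋂ cs ⊆ ⋂ (bs ++ cs)
      join []       x h = proj₂ (∩⁻ {A = full} {⋂ cs} h)
      join (b ∷ bs) x h =
        let h′ , hcs = ∩⁻ {A = ⋂ (b ∷ bs)} {⋂ cs} h
            hb , hbs = ∩⁻ {A = basic b} {⋂ bs} h′
        in ∩⁺ {A = basic b} {⋂ (bs ++ cs)} hb (join bs x (∩⁺ {A = ⋂ bs} {⋂ cs} hbs hcs))

    Λ-∩ : Λ A → Λ B → Λ (A ∩ B)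
    Λ-∩ {B = B} hA hB = Λ-∩-from hB (λ bs → Λ-ext (∩-comm B (⋂ bs) , ∩-comm (⋂ bs) B)
      (Λ-∩-from (Λ-⋂ bs) (λ cs → Λ-ext (⋂-++ cs bs) (Λ-⋂ (cs ++ bs))) hB)) hA

    π-λ : ∀ A → Λ A
    π-λ (basic b) = Λ-ext
      ((λ x → proj₁ ∘ ∩⁻ {A = basic b} {full}) , (λ x h → ∩⁺ {A = basic b} {full} h id)) (Λ-⋂ (b ∷ []))
    π-λ ∅         = Λ-∅
    π-λ (∁ A)     = Λ-∁ (π-λ A)
    π-λ (⋃ A)     = Λ-ext (proj₂ (⋃-fresh A) , proj₁ (⋃-fresh A))
      (Λ-⋃ (fresh-disjoint A) λ n → Λ-∩ (π-λ (A n)) (Λ-∁ (Λ-before n)))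
      where
      Λ-before : ∀ n → Λ (before A n)
      Λ-before zero    = Λ-∅
      Λ-before (suc n) = Λ-ext
        ( (λ { x (0 , h) → 0 , h ; x (1 , h) → 1 , proj₁ (∩⁻ {A = A n} {∁ before A n} h) })
        , (λ { x (0 , h) → 0 , h ; x (1 , h) → new x h }) )
        (Λ-⊎ (λ x h k → proj₂ (∩⁻ {A = A n} {∁ before A n} k) h)
          (Λ-before n) (Λ-∩ (π-λ (A n)) (Λ-∁ (Λ-before n))))
        where
        new : A n ⊆ before A n ∪ fresh A n
        new x h with em {x ∈ before A n}
        ... | yes p = 0 , p
        ... | no ¬p = 1 , ∩⁺ {A = A n} {∁ before A n} h ¬p

-- Complements and unions of events have their classical meaning only under
-- excluded middle, which is therefore a parameter of the semantics.
module pGCL (em : ExcludedMiddle 0ℓ) (Var : Set) (countable : Var ↣ ℕ) where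

  open MeasureTheory em

  _≟_ : (x y : Var) → Dec (x ≡ y)
  x ≟ y with Injection.to countable x ℕ.≟ Injection.to countable y
  ... | yes e = yes (Injection.injective countable e)
  ... | no ¬e = no λ { refl → ¬e refl }

  State : Set
  State = Var → ℝ

  infix 9 _[_↦_]

  _[_↦_] : State → Var → ℝ → State
  (σ [ x ↦ v ]) y with x ≟ y
  ... | yes _ = v
  ... | no  _ = σ y

  -- Product σ-algebra on states, generated by the sets {σ | σ(x) < q}
  States : MeasurableSpace 0ℓ
  States = record { Carrier = State ; Basic = Var × ℚ ; _∈ᵇ_ = λ σ (x , q) → σ x ʳ< q }

  Predicate : Set
  Predicate = Event States

  infix 4 _⊨_ _⇒_

  _⊨_ : State → Predicate → Set
  σ ⊨ φ = σ ∈ φ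

  _⇒_ : Predicate → Predicate → Set
  φ ⇒ ψ = ∀ σ → σ ⊨ φ → σ ⊨ ψ

  record Expression : Set where
    field
      eval       : State → ℝ
      measurable : Measurable States Borel eval

  record Probability : Set where
    field
      prob : ℝ
      0≤p  : ¬ prob ʳ< 0ℚ
      p≤1  : ¬ 1ℚ <ʳ prob

  Distribution : Set₁
  Distribution = ProbabilityMeasure Borel

  infix  12 _≔_ _:≈_
  infixr 11 _⨾_

  data Program : Set₁ where
    skip          : Program
    _≔_           : Var → Expression → Program
    _:≈_          : Var → Distribution → Program
    _⨾_           : Program → Program → Program
    choice        : Program → Probability → Program → Program
    if_then_else_ : Predicate → Program → Program → Program
    while         : Predicate → Program → Program

  record 𝔼 : Set₁ where
    no-eta-equality
    field
      _⟨_⟩       : State → ℝ∞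
      measurable : Measurable States Borel∞ _⟨_⟩

  open 𝔼 using (_⟨_⟩)

  infix 4 _⪯_ _≋_

  _⪯_ _≋_ : 𝔼 → 𝔼 → Set
  f ⪯ g = ∀ σ → f ⟨ σ ⟩ ≤∞ g ⟨ σ ⟩
  f ≋ g = f ⪯ g × g ⪯ f

  rays : ∀ f → Rays {X = States} (f ⟨_⟩)
  rays f q = 𝔼.measurable f (basic q)

  infixl 6 _⊕_
  infixl 7 _·_

  const : ℝ∞ → 𝔼
  const a ⟨ σ ⟩ = a
  𝔼.measurable (const a) = fromBasic (rays-const a)

  [_] : Predicate → 𝔼
  [ φ ] ⟨ σ ⟩ = 𝟙 φ σ
  𝔼.measurable [ φ ] = fromBasic (rays-𝟙 φ)

  _⊕_ _·_ : 𝔼 → 𝔼 → 𝔼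
  (f ⊕ g) ⟨ σ ⟩ = f ⟨ σ ⟩ +∞ g ⟨ σ ⟩
  𝔼.measurable (f ⊕ g) = fromBasic (rays-+ {f = f ⟨_⟩} {g ⟨_⟩} (rays f) (rays g))
  (f · g) ⟨ σ ⟩ = f ⟨ σ ⟩ *∞ g ⟨ σ ⟩
  𝔼.measurable (f · g) = fromBasic (rays-* {f = f ⟨_⟩} {g ⟨_⟩} (rays f) (rays g))

  sup : (ℕ → 𝔼) → 𝔼
  sup u ⟨ σ ⟩ = ⨆ λ n → u n ⟨ σ ⟩
  𝔼.measurable (sup u) = fromBasic (rays-⨆ {u = λ n → u n ⟨_⟩} (λ n → rays (u n)))

  ⪯-trans : ∀ f g h → f ⪯ g → g ⪯ h → f ⪯ h
  ⪯-trans f g h f⪯g g⪯h σ = ≤∞-trans (f⪯g σ) (g⪯h σ)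

  Ascending : (ℕ → 𝔼) → Set
  Ascending u = ∀ n → u n ⪯ u (suc n)

  -- ω-continuity is what makes the least fixed point of a loop exist among the
  -- measurable functions: it is the supremum of the Kleene iterates.
  record Transformer : Set₁ where
    field
      apply      : 𝔼 → 𝔼
      monotone   : ∀ f g → f ⪯ g → apply f ⪯ apply g
      continuous : ∀ u → Ascending u → apply (sup u) ⪯ sup (λ n → apply (u n))

  open Transformer

  record IsLeastFixedPoint (Ψ : 𝔼 → 𝔼) (h : 𝔼) : Set₁ where
    field
      fixed : Ψ h ≋ h
      least : ∀ g → Ψ g ≋ g → h ⪯ g

  module _ (T : Transformer) where

    iterate : ℕ → 𝔼
    iterate zero    = const 0∞
    iterate (suc n) = apply T (iterate n)

    iterate-ascending : Ascending iterate
    iterate-ascending zero    σ = 0≤∞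
    iterate-ascending (suc n) = monotone T (iterate n) (iterate (suc n)) (iterate-ascending n)

    lfp : 𝔼
    lfp = sup iterate

    lfp-below-prefixed : ∀ g → apply T g ⪯ g → lfp ⪯ g
    lfp-below-prefixed g Tg⪯g σ = ⨆-least (λ n → iterate-below n σ)
      where
      iterate-below : ∀ n → iterate n ⪯ g
      iterate-below zero    σ = 0≤∞
      iterate-below (suc n) σ = ≤∞-trans (monotone T (iterate n) g (iterate-below n) σ) (Tg⪯g σ)

    lfp-isLeastFixedPoint : IsLeastFixedPoint (apply T) lfp
    lfp-isLeastFixedPoint = record
      { fixed =
          (λ σ → ≤∞-trans (continuous T iterate iterate-ascending σ) (⨆-least (λ n → ⨆-upper _ (suc n)))) ,
          (λ σ → ⨆-least λ n → ≤∞-trans (iterate-ascending n σ)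
            (monotone T (iterate n) lfp (λ τ → ⨆-upper _ n) σ))
      ; least = λ g Tg≋g → lfp-below-prefixed g (proj₁ Tg≋g)
      }

  weighted-mono : ∀ v w f f′ g g′ → f ⪯ f′ → g ⪯ g′ → v · f ⊕ w · g ⪯ v · f′ ⊕ w · g′
  weighted-mono v w f f′ g g′ h k σ = +-mono (*-mono ≤∞-refl (h σ)) (*-mono ≤∞-refl (k σ))

  weighted-continuous : ∀ v w t u → Ascending t → Ascending u →
                        v · sup t ⊕ w · sup u ⪯ sup (λ n → v · t n ⊕ w · u n)
  weighted-continuous v w t u asc-t asc-u σ = ≤∞-trans (+-mono *-⨆ *-⨆)
    (⨆-+ (λ n → *-mono ≤∞-refl (asc-t n σ)) (λ n → *-mono ≤∞-refl (asc-u n σ)))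

  apply-ascending : ∀ T u → Ascending u → Ascending (λ n → apply T (u n))
  apply-ascending T u asc n = monotone T (u n) (u (suc n)) (asc n)

  identity : Transformer
  identity = record { apply = id ; monotone = λ _ _ → id ; continuous = λ u asc σ → ≤∞-refl }

  compose : Transformer → Transformer → Transformer
  compose S T = record
    { apply      = λ f → apply S (apply T f)
    ; monotone   = λ f g h → monotone S (apply T f) (apply T g) (monotone T f g h)
    ; continuous = λ u asc σ → ≤∞-trans
        (monotone S (apply T (sup u)) (sup λ n → apply T (u n)) (continuous T u asc) σ)
        (continuous S (λ n → apply T (u n)) (apply-ascending T u asc) σ)
    }

  mix : 𝔼 → Transformer → 𝔼 → Transformer → Transformer
  mix v S w T = record
    { apply      = λ f → v · apply S f ⊕ w · apply T f
    ; monotone   = λ f g h → weighted-mono v w (apply S f) (apply S g) (apply T f) (apply T g)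
                     (monotone S f g h) (monotone T f g h)
    ; continuous = λ u asc σ → ≤∞-trans
        (weighted-mono v w (apply S (sup u)) (sup λ n → apply S (u n)) (apply T (sup u)) (sup λ n → apply T (u n))
          (continuous S u asc) (continuous T u asc) σ)
        (weighted-continuous v w (λ n → apply S (u n)) (λ n → apply T (u n))
          (apply-ascending S u asc) (apply-ascending T u asc) σ)
    }

  module _ (x : Var) (e : Expression) where

    open Expression e

    assign : State → State
    assign σ = σ [ x ↦ eval σ ]

    assign-measurable : Measurable States States assign
    assign-measurable = fromBasic preimage
      where
      preimage : ∀ ((y , q) : Var × ℚ) → MeasurableSet States (λ σ → assign σ y ʳ< q)
      preimage (y , q) with x ≟ y
      ... | yes _ = measurable (basic q)
      ... | no  _ = basic (y , q) , λ σ → mk⇔ id id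

    assignment : Transformer
    apply      assignment f = record
      { _⟨_⟩       = λ σ → f ⟨ σ [ x ↦ eval σ ] ⟩
      ; measurable = λ B →
          let A , h = 𝔼.measurable f B
              D , k = assign-measurable A
          in D , λ σ → mk⇔ (to (h (assign σ)) ∘ to (k σ)) (from (k σ) ∘ from (h (assign σ)))
      }
    monotone   assignment f g f⪯g σ = f⪯g (assign σ)
    continuous assignment u asc σ   = ≤∞-refl

  module _ (x : Var) (μ : Distribution) where

    update-measurable : ∀ σ → Measurable Borel States (σ [ x ↦_])
    update-measurable σ = fromBasic preimage
      where
      preimage : ∀ ((y , q) : Var × ℚ) → MeasurableSet Borel (λ v → (σ [ x ↦ v ]) y ʳ< q)
      preimage (y , q) with x ≟ y
      ... | yes _ = basic q , λ v → mk⇔ id id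
      ... | no  _ = set-const (σ y ʳ< q)

    slice : State → Event States → Event Borel
    slice σ A = proj₁ (update-measurable σ A)

    slice-spec : ∀ σ A v → v ∈ slice σ A ⇔ σ [ x ↦ v ] ∈ A
    slice-spec σ A = proj₂ (update-measurable σ A)

    slice-mono : ∀ σ A B → A ⊆ B → slice σ A ⊆ slice σ B
    slice-mono σ A B A⊆B v = from (slice-spec σ B v) ∘ A⊆B (σ [ x ↦ v ]) ∘ to (slice-spec σ A v)

    slice-∩ : ∀ σ A B → slice σ A ∩ slice σ B ≐ slice σ (A ∩ B)
    slice-∩ σ A B =
      (λ v m → let a , b = ∩⁻ {A = slice σ A} {slice σ B} m in
        from (slice-spec σ (A ∩ B) v) (∩⁺ {A = A} {B} (to (slice-spec σ A v) a) (to (slice-spec σ B v) b))) ,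
      (λ v m → let a , b = ∩⁻ {A = A} {B} (to (slice-spec σ (A ∩ B) v) m) in
        ∩⁺ {A = slice σ A} {slice σ B} (from (slice-spec σ A v) a) (from (slice-spec σ B v) b))

    -- σ ↦ μ(A_σ) is measurable for every event A with slices A_σ.

    Sliceable : Event States → Set
    Sliceable A = Rays {X = States} (λ σ → measure μ (slice σ A))

    rays-ext′ : ∀ {f g : State → ℝ∞} → (∀ σ → f σ ≈∞ g σ) → Rays {X = States} f → Rays {X = States} g
    rays-ext′ = rays-ext

    cylinder : ∀ bs S → Rays {X = States} (λ σ → measure μ (S ∩ slice σ (⋂ bs)))
    cylinder [] S = rays-ext′ (λ σ → cong-≐ μ
      ( (λ v h → ∩⁺ {A = S} {slice σ full} h (from (slice-spec σ full v) id))
      , (λ v m → proj₁ (∩⁻ {A = S} {slice σ full} m)) ))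
      (rays-const (measure μ S))
    cylinder ((y , q) ∷ bs) S = split (x ≟ y)
      where
      rest : State → Event Borel
      rest σ = slice σ (⋂ bs)
      head : State → Event Borel
      head σ = slice σ (basic (y , q))
      unfold : ∀ σ → S ∩ slice σ (⋂ ((y , q) ∷ bs)) ≐ (S ∩ head σ) ∩ rest σ
      unfold σ =
        (λ v m → let s , h = ∩⁻ {A = S} {slice σ (⋂ ((y , q) ∷ bs))} m
                     k , l = ∩⁻ {A = head σ} {rest σ} (proj₂ (slice-∩ σ (basic (y , q)) (⋂ bs)) v h)
                 in ∩⁺ {A = S ∩ head σ} {rest σ} (∩⁺ {A = S} {head σ} s k) l) ,
        (λ v m → let sk , l = ∩⁻ {A = S ∩ head σ} {rest σ} m
                     s , k  = ∩⁻ {A = S} {head σ} sk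
                 in ∩⁺ {A = S} {slice σ (⋂ ((y , q) ∷ bs))} s
                      (proj₁ (slice-∩ σ (basic (y , q)) (⋂ bs)) v (∩⁺ {A = head σ} {rest σ} k l)))
      split : Dec (x ≡ y) → Rays {X = States} (λ σ → measure μ (S ∩ slice σ (⋂ ((y , q) ∷ bs))))
      split (yes x≡y) = rays-ext′ (λ σ → ≈∞-trans
          (cong-≐ μ {(S ∩ basic q) ∩ rest σ} {(S ∩ head σ) ∩ rest σ}
            (∩-mono {A = S ∩ basic q} {S ∩ head σ} (rest σ) (forth σ) ,
             ∩-mono {A = S ∩ head σ} {S ∩ basic q} (rest σ) (back σ)))
          (≈∞-sym (cong-≐ μ {S ∩ slice σ (⋂ ((y , q) ∷ bs))} {(S ∩ head σ) ∩ rest σ} (unfold σ))))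
        (cylinder bs (S ∩ basic q))
        where
        same : ∀ σ v → (σ [ x ↦ v ]) y ≡ v
        same σ v with x ≟ y
        ... | yes _ = refl
        ... | no ¬e = contradiction x≡y ¬e
        forth : ∀ σ → S ∩ basic q ⊆ S ∩ head σ
        forth σ v m = let s , k = ∩⁻ {A = S} {basic q} m in
          ∩⁺ {A = S} {head σ} s (from (slice-spec σ (basic (y , q)) v) (subst (_ʳ< q) (sym (same σ v)) k))
        back : ∀ σ → S ∩ head σ ⊆ S ∩ basic q
        back σ v m = let s , k = ∩⁻ {A = S} {head σ} m in
          ∩⁺ {A = S} {basic q} s (subst (_ʳ< q) (same σ v) (to (slice-spec σ (basic (y , q)) v) k))
      split (no x≢y) = rays-ext′ (λ σ → ≈∞-trans (scaled σ) (≈∞-sym (cong-≐ μ {S ∩ slice σ (⋂ ((y , q) ∷ bs))} {(S ∩ head σ) ∩ rest σ} (unfold σ))))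
        (rays-* {f = 𝟙 {X = States} (basic (y , q))} {λ σ → measure μ (S ∩ rest σ)}
          (rays-𝟙 (basic (y , q))) (cylinder bs S))
        where
        other : ∀ σ v → (σ [ x ↦ v ]) y ≡ σ y
        other σ v with x ≟ y
        ... | yes e = contradiction e x≢y
        ... | no  _ = refl
        cyl : Event States
        cyl = basic (y , q)
        scaled : ∀ σ → 𝟙 cyl σ *∞ measure μ (S ∩ rest σ) ≈∞ measure μ ((S ∩ head σ) ∩ rest σ)
        scaled σ with em {σ y ʳ< q}
        ... | yes h = ≤∞-trans (𝟙*-≤ cyl) (μ-mono μ (∩-mono (rest σ) λ v s →
                        ∩⁺ {A = S} {head σ} s (from (slice-spec σ (basic (y , q)) v) (subst (_ʳ< q) (sym (other σ v)) h)))) ,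
                      ≤∞-trans (μ-mono μ (∩-mono (rest σ) λ v m → proj₁ (∩⁻ {A = S} {head σ} m)))
                        (𝟙*-∈ cyl h)
        ... | no ¬h = ≤∞-trans (𝟙*-∉ cyl ¬h) 0≤∞ ,
                      ≤∞-trans (μ-mono μ {B = ∅} (λ v m → ¬h (subst (_ʳ< q) (other σ v)
                        (to (slice-spec σ (basic (y , q)) v)
                          (proj₂ (∩⁻ {A = S} {head σ} (proj₁ (∩⁻ {A = S ∩ head σ} {rest σ} m))))))))
                      (≤∞-trans (proj₁ (empty μ)) 0≤∞)

    measure-∁ : ∀ A q → below (measure μ (∁ A)) q ⇔ (∃[ r ] q < r × ¬ below (measure μ A) (1ℚ - r))
    measure-∁ A q = mk⇔ forth back
      where
      sum≈1 : measure μ A +∞ measure μ (∁ A) ≈∞ 1∞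
      sum≈1 = ≈∞-trans (≈∞-sym (≈∞-trans (cong-≐ μ (cover , λ _ _ → id)) (μ-∪ μ (λ x h k → k h)))) (total μ)
        where
        cover : full ⊆ A ∪ ∁ A
        cover v _ with em {v ∈ A}
        ... | yes h = 0 , h
        ... | no ¬h = 1 , ¬h
      ¬1<1 : ¬ below 1∞ 1ℚ
      ¬1<1 (inj₁ 1<0) = ℚ.<-asym 1<0 (ℚ.positive⁻¹ 1ℚ)
      ¬1<1 (inj₂ 1<1) = ℚ.<-irrefl refl 1<1
      forth : below (measure μ (∁ A)) q → ∃[ r ] q < r × ¬ below (measure μ A) (1ℚ - r)
      forth h = let r , q<r , h′ = rounded (measure μ (∁ A)) h in
        r , q<r , λ k → ¬1<1 (below-mono (proj₁ sum≈1) (1ℚ - r , r , k , h′ , ℚ.≤-reflexive (sym (p-q+q 1ℚ r))))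
      back : ∃[ r ] q < r × ¬ below (measure μ A) (1ℚ - r) → below (measure μ (∁ A)) q
      back (r , q<r , ¬k) = dne λ ¬h →
        let t = 1ℚ - r + q
            t<1 : t < 1ℚ
            t<1 = subst (t <_) (p-q+q 1ℚ r) (ℚ.+-monoʳ-< (1ℚ - r) q<r)
            a , b , ha , hb , t≤a+b = below-mono (proj₂ sum≈1) {t} (inj₂ t<1)
            a<1-r = ℚ.≰⇒> (λ 1-r≤a → ¬k (downward (measure μ A) 1-r≤a ha))
            b<q   = ℚ.≰⇒> (λ q≤b → ¬h (downward (measure μ (∁ A)) q≤b hb))
        in <⇒≱ (ℚ.+-mono-< a<1-r b<q) t≤a+b

    sliceable : ∀ {A} → Λ A → Sliceable A
    sliceable (Λ-⋂ bs) = rays-ext′ (λ σ → cong-≐ μ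
      ( (λ v m → proj₂ (∩⁻ {A = full} {slice σ (⋂ bs)} m))
      , (λ v h → ∩⁺ {A = full} {slice σ (⋂ bs)} id h) )) (cylinder bs full)
    sliceable (Λ-∁ {A} h) q = set-ext
      (λ σ → mk⇔ (from (measure-∁ (slice σ A) q)) (to (measure-∁ (slice σ A) q)))
      (set-∃ℚ λ r → set-× (set-const (q < r)) (set-¬ (sliceable h (1ℚ - r))))
    sliceable (Λ-⋃ {A} d h) = rays-ext′
      (λ σ → ≈∞-sym (additive μ (λ n → slice σ (A n)) λ m n m≢n v hm hn →
        d m n m≢n (σ [ x ↦ v ]) (to (slice-spec σ (A m) v) hm) (to (slice-spec σ (A n) v) hn)))
      (rays-⨆ {u = λ n σ → ∑< n λ k → measure μ (slice σ (A k))}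
        (rays-∑< {u = λ n σ → measure μ (slice σ (A n))} (λ n → sliceable (h n))))
    sliceable (Λ-ext {A} {B} (A⊆B , B⊆A) h) =
      rays-ext′ (λ σ → cong-≐ μ (slice-mono σ A B A⊆B , slice-mono σ B A B⊆A)) (sliceable h)

    module _ (f : 𝔼) where

      threshold : State → ℚ → Event Borel
      threshold σ q = slice σ (proj₁ (rays f q))

      threshold-spec : ∀ σ q v → v ∈ threshold σ q ⇔ below (f ⟨ σ [ x ↦ v ] ⟩) q
      threshold-spec σ q v =
        let h = slice-spec σ (proj₁ (rays f q)) v
            k = proj₂ (rays f q) (σ [ x ↦ v ])
        in mk⇔ (to k ∘ to h) (from h ∘ from k)

      module Steps σ = Thresholds μ (λ v → f ⟨ σ [ x ↦ v ] ⟩) (threshold σ) (threshold-spec σ)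

      rays-steps : ∀ L R v → Rays {X = States} (λ σ → Steps.steps σ L (slice σ R) v)
      rays-steps []      R v = rays-* {f = λ _ → ι v} {λ σ → measure μ (slice σ R)} (rays-const (ι v)) (sliceable (π-λ R))
      rays-steps (r ∷ L) R v = rays-ext′
        (λ σ → +-cong
          (Steps.steps-mono σ L {slice σ (R ∩ F)} {slice σ R ∩ slice σ F} (proj₂ (slice-∩ σ R F)) ℚ.≤-refl , Steps.steps-mono σ L {slice σ R ∩ slice σ F} {slice σ (R ∩ F)} (proj₁ (slice-∩ σ R F)) ℚ.≤-refl)
          (Steps.steps-mono σ L {slice σ (R ∩ ∁ F)} {slice σ R ∩ slice σ (∁ F)} (proj₂ (slice-∩ σ R (∁ F))) ℚ.≤-refl ,
           Steps.steps-mono σ L {slice σ R ∩ slice σ (∁ F)} {slice σ (R ∩ ∁ F)} (proj₁ (slice-∩ σ R (∁ F))) ℚ.≤-refl))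
        (rays-+ {f = λ σ → Steps.steps σ L (slice σ (R ∩ F)) (v ⊔ r)} {λ σ → Steps.steps σ L (slice σ (R ∩ ∁ F)) v}
          (rays-steps L (R ∩ F) (v ⊔ r)) (rays-steps L (R ∩ ∁ F) v))
        where
        F : Event States
        F = proj₁ (rays f r)

      ∫-rays : Rays {X = States} (λ σ → ∫ μ (λ v → f ⟨ σ [ x ↦ v ] ⟩))
      ∫-rays = rays-ext′ (λ σ → ≈∞-sym (Steps.∫≈sup-steps σ)) λ q → set-∃List λ L → rays-steps L full 0ℚ q

    sampling : Transformer
    apply      sampling f = record
      { _⟨_⟩       = λ σ → ∫ μ (λ v → f ⟨ σ [ x ↦ v ] ⟩)
      ; measurable = fromBasic (∫-rays f)
      }
    monotone   sampling f g f⪯g σ = ∫-mono μ (λ v → f⪯g (σ [ x ↦ v ]))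
    continuous sampling u asc σ   = monotone-convergence μ (λ n v → u n ⟨ σ [ x ↦ v ] ⟩)
      (λ v n → asc n (σ [ x ↦ v ])) (λ n → threshold (u n) σ) (λ n → threshold-spec (u n) σ)

  module _ (φ : Predicate) (T : Transformer) where

    -- h ↦ [¬φ] · f + [φ] · T(h)
    characteristic : 𝔼 → Transformer
    characteristic f = record
      { apply      = λ h → [ ∁ φ ] · f ⊕ [ φ ] · apply T h
      ; monotone   = λ g h k → weighted-mono [ ∁ φ ] [ φ ] f f (apply T g) (apply T h) (λ σ → ≤∞-refl) (monotone T g h k)
      ; continuous = λ u asc σ → ≤∞-trans
          (weighted-mono [ ∁ φ ] [ φ ] f (sup λ n → f) (apply T (sup u)) (sup λ n → apply T (u n))
            (λ τ → ⨆-upper _ 0) (continuous T u asc) σ)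
          (weighted-continuous [ ∁ φ ] [ φ ] (λ n → f) (λ n → apply T (u n))
            (λ n τ → ≤∞-refl) (apply-ascending T u asc) σ)
      }

    loop : Transformer
    loop = record { apply = W ; monotone = W-mono ; continuous = W-continuous }
      where
      W : 𝔼 → 𝔼
      W f = lfp (characteristic f)
      W-fixed : ∀ f → apply (characteristic f) (W f) ⪯ W f
      W-fixed f = proj₁ (IsLeastFixedPoint.fixed (lfp-isLeastFixedPoint (characteristic f)))
      W-mono : ∀ f g → f ⪯ g → W f ⪯ W g
      W-mono f g f⪯g = lfp-below-prefixed (characteristic f) (W g) λ σ → ≤∞-trans
        (weighted-mono [ ∁ φ ] [ φ ] f g (apply T (W g)) (apply T (W g)) f⪯g (λ τ → ≤∞-refl) σ)
        (W-fixed g σ)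
      W-continuous : ∀ u → Ascending u → W (sup u) ⪯ sup (λ n → W (u n))
      W-continuous u asc = lfp-below-prefixed (characteristic (sup u)) (sup w) λ σ → ≤∞-trans
        (weighted-mono [ ∁ φ ] [ φ ] (sup u) (sup u) (apply T (sup w)) (sup λ n → apply T (w n))
          (λ τ → ≤∞-refl) (continuous T w asc-w) σ)
        (≤∞-trans (weighted-continuous [ ∁ φ ] [ φ ] u (λ n → apply T (w n)) asc (apply-ascending T w asc-w) σ)
          (⨆-mono λ n → W-fixed (u n) σ))
        where
        w : ℕ → 𝔼
        w n = W (u n)
        asc-w : Ascending w
        asc-w n = W-mono (u n) (u (suc n)) (asc n)

  transformer : Program → Transformer
  transformer skip                  = identity
  transformer (x ≔ e)               = assignment x e
  transformer (x :≈ μ)              = sampling x μ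
  transformer (C ⨾ D)               = compose (transformer C) (transformer D)
  transformer (choice C p D)        = mix (const (fromℝ prob)) (transformer C) (const (fromℝ (1-ʳ prob))) (transformer D)
    where open Probability p
  transformer (if φ then C else D)  = mix [ φ ] (transformer C) [ ∁ φ ] (transformer D)
  transformer (while φ C)           = loop φ (transformer C)

  wp : Program → 𝔼 → 𝔼
  wp C = apply (transformer C)

  wp-skip : ∀ f → wp skip f ≡ f
  wp-skip f = refl

  wp-assign : ∀ x e f σ → wp (x ≔ e) f ⟨ σ ⟩ ≡ f ⟨ σ [ x ↦ Expression.eval e σ ] ⟩
  wp-assign x e f σ = refl

  wp-sample : ∀ x μ f σ → wp (x :≈ μ) f ⟨ σ ⟩ ≡ ∫ μ (λ v → f ⟨ σ [ x ↦ v ] ⟩)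
  wp-sample x μ f σ = refl

  wp-seq : ∀ C D f → wp (C ⨾ D) f ≡ wp C (wp D f)
  wp-seq C D f = refl

  wp-choice : ∀ C p D f → let open Probability p in
              wp (choice C p D) f ≡ const (fromℝ prob) · wp C f ⊕ const (fromℝ (1-ʳ prob)) · wp D f
  wp-choice C p D f = refl

  wp-if : ∀ φ C D f → wp (if φ then C else D) f ≡ [ φ ] · wp C f ⊕ [ ∁ φ ] · wp D f
  wp-if φ C D f = refl

  wp-while : ∀ φ C f → IsLeastFixedPoint (λ h → [ ∁ φ ] · f ⊕ [ φ ] · wp C h) (wp (while φ C) f)
  wp-while φ C f = lfp-isLeastFixedPoint (characteristic φ (transformer C) f)

{-# OPTIONS --safe #-}
-- By Park induction it suffices that W = wp⟦while(φ){C}⟧(f) is a prefixed point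
-- of the characteristic map of while(φ′){C} with postexpectation [¬φ]·f.  This
-- holds because [¬φ′]·([¬φ]·f) ⪯ [¬φ]·f and [φ′] ⪯ [φ], so that map is dominated
-- by the characteristic map of while(φ){C} with postexpectation f.
module Submission where

open import Axiom.ExcludedMiddle using (ExcludedMiddle)
open import Data.Nat.Base using (ℕ)
open import Data.Product using (_,_; proj₁)
open import Data.Sum.Base using (inj₁; inj₂)
open import Function.Bundles using (_↣_)
open import Level using (0ℓ)
open import Defs

module _ (em : ExcludedMiddle 0ℓ) (Var : Set) (countable : Var ↣ ℕ) where

  open pGCL em Var countable
  open MeasureTheory em

  [⇒]-mono : ∀ φ ψ → φ ⇒ ψ → [ φ ] ⪯ [ ψ ]
  [⇒]-mono φ ψ φ⇒ψ σ = le λ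
    { (inj₁ q<0)         → inj₁ q<0
    ; (inj₂ (σ⊨φ , q<1)) → inj₂ (φ⇒ψ σ σ⊨φ , q<1)
    }

  wp-while-prefixed : ∀ φ C f → [ ∁ φ ] · f ⊕ [ φ ] · wp C (wp (while φ C) f) ⪯ wp (while φ C) f
  wp-while-prefixed φ C f = proj₁ (IsLeastFixedPoint.fixed (wp-while φ C f))

  -- Park induction: every Kleene iterate stays below a prefixed point, hence so does their
  -- supremum. The field `least` of `IsLeastFixedPoint` compares with genuine fixed points only.
  wp-while-least : ∀ φ C f h → [ ∁ φ ] · f ⊕ [ φ ] · wp C h ⪯ h → wp (while φ C) f ⪯ h
  wp-while-least φ C f = lfp-below-prefixed (characteristic φ (transformer C) f)

  wp-while-strengthen : ∀ C φ φ′ f → φ′ ⇒ φ → wp (while φ′ C) ([ ∁ φ ] · f) ⪯ wp (while φ C) f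
  wp-while-strengthen C φ φ′ f φ′⇒φ = wp-while-least φ′ C ([ ∁ φ ] · f) W λ σ → ≤∞-trans
    -- `[ ∁ φ′ ]` is at most 1 and drops out; the factor `[ ∁ φ ]` built into the postexpectation
    -- remains and gives the exit term of the loop with guard `φ`.
    (+-mono (𝟙*-≤ (∁ φ′)) (*-mono ([⇒]-mono φ′ φ φ′⇒φ σ) ≤∞-refl))
    (wp-while-prefixed φ C f σ)
    where
    W : 𝔼
    W = wp (while φ C) f

theorem14 : (em : ExcludedMiddle 0ℓ) (Var : Set) (countable : Var ↣ ℕ) →
    let open pGCL em Var countable in
    (C : Program) (φ φ′ : Predicate) (f l : 𝔼) →
    φ′ ⇒ φ →
    l ⪯ wp (while φ′ C) ([ ∁ φ ] · f) →
    l ⪯ wp (while φ C) f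
theorem14 em Var countable C φ φ′ f l φ′⇒φ l⪯W′ =
  ⪯-trans l (wp (while φ′ C) ([ ∁ φ ] · f)) (wp (while φ C) f) l⪯W′
    (wp-while-strengthen em Var countable C φ φ′ f φ′⇒φ)
  where open pGCL em Var countable
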